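{- Let $G=(V,E)$ be a graph with $n\ge 4$ vertices and maximum degree $\Delta(G)=n-2$. If $|E|=m\le 2n-5$, then $G$ is antimagic.
   Context: All graphs are finite, undirected and simple; $\Delta(G)$ denotes the maximum degree of $G$. An antimagic labeling of a graph with $m$ edges and $n$ vertices is a bijection from the set of edges to the integers $\{1,\ldots,m\}$ such that all $n$ vertex sums are pairwise distinct, where a vertex sum is the sum of the labels of all edges incident with that vertex (an isolated vertex has vertex sum $0$). A graph is called antimagic if it has an antimagic labeling. -}

module Defs where

open import Data.Bool using (Bool; false; T; T?)
open import Data.Fin using (Fin; toℕ; _<_)
open import Data.Fin.Properties using (_≟_; _<?_)
open import Data.List using (List; length; map; filter; mapMaybe; allFin; cartesianProduct)
open import Data.List.Extrema.Nat using (max)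
open import Data.Maybe using (Maybe)
import Data.Maybe as Maybe
open import Data.Nat using (ℕ; suc)
open import Data.Nat.ListAction using (sum)
open import Data.Product using (∃-syntax; _×_; _,_)
open import Data.Sum using (_⊎_)
open import Function.Bundles using (_⤖_; Bijection)
open import Function.Definitions using (Injective)
open import Relation.Binary.PropositionalEquality using (_≡_)
open import Relation.Nullary.Decidable using (Dec; _×-dec_; _⊎-dec_; dec⇒maybe)

record Graph (n : ℕ) : Set where
  field
    adj    : Fin n → Fin n → Bool
    symm   : ∀ u v → adj u v ≡ adj v u
    irrefl : ∀ u → adj u u ≡ false

module _ {n : ℕ} (G : Graph n) where
  open Graph G

  degree : Fin n → ℕ
  degree v = length (filter (λ u → T? (adj v u)) (allFin n))

  -- The default value 0 does not affect the maximum, as degrees are natural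
  -- numbers.
  Δ : ℕ
  Δ = max 0 (map degree (allFin n))

  -- An undirected edge {i , j} is represented by the ordered pair with i < j.
  -- The proof fields are propositions, so every edge has exactly one
  -- representative up to _≡_.
  record Edge : Set where
    constructor mkEdge
    field
      i j      : Fin n
      i<j      : i < j
      adjacent : T (adj i j)

  toEdge : Fin n × Fin n → Maybe Edge
  toEdge (i , j) =
    Maybe.map (λ (i<j , a) → mkEdge i j i<j a) (dec⇒maybe (i <? j ×-dec T? (adj i j)))

  edges : List Edge
  edges = mapMaybe toEdge (cartesianProduct (allFin n) (allFin n))

  ∣E∣ : ℕ
  ∣E∣ = length edges

  Incident : Fin n → Edge → Set
  Incident v e = v ≡ Edge.i e ⊎ v ≡ Edge.j e

  incident? : ∀ v e → Dec (Incident v e)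
  incident? v e = (v ≟ Edge.i e) ⊎-dec (v ≟ Edge.j e)

  -- The label set {1,…,m} is represented by Fin m, with k : Fin m standing for
  -- the integer 1 + toℕ k.
  Labeling : Set
  Labeling = Edge ⤖ Fin ∣E∣

  label : Labeling → Edge → ℕ
  label f e = suc (toℕ (Bijection.to f e))

  vertexSum : Labeling → Fin n → ℕ
  vertexSum f v = sum (map (label f) (filter (incident? v) edges))

  IsAntimagicLabeling : Labeling → Set
  IsAntimagicLabeling f = Injective _≡_ _≡_ (vertexSum f)

  Antimagic : Set
  Antimagic = ∃[ f ] IsAntimagicLabeling f

{-# OPTIONS --safe #-}
-- Let v have degree n − 2, let u be its non-neighbour, H the set of k ≤ n − 3
-- edges avoiding v, and call the H-sum of a vertex its partial sum. Once H is
-- labelled, giving the remaining labels to the edges at v in increasing order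
-- of the partial sums of their other ends makes the sums at the neighbours of v
-- distinct, so only collisions with u or v have to be excluded.
--   If u has at most one edge, H takes the labels 1, …, k and nothing collides.
-- Otherwise H takes even labels only, so a neighbour of v with an odd label at v
-- never collides with u. The even labels left for the edges at v are kept small
-- and so go to neighbours with small partial sums: at most k − 1 neighbours have
-- two or more edges in H, and any other one has a partial sum not exceeding the
-- largest label in H, which is put at u together with the second largest.
-- The sum at v then exceeds all others, by double counting the degrees in H.
-- With k = 2 this fails for n = 5 and n = 6, and H takes the labels 2 and m.
module Submission where

open import Defs
open import Data.Bool using (T; T?)
open import Data.Bool.Properties using (T-irrelevant)
open import Data.Empty using (⊥; ⊥-elim)
open import Data.Fin using (Fin; toℕ; fromℕ<; combine)
import Data.Fin as Fin
import Data.Fin.Properties as Finₚ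
open import Data.List using (List; []; _∷_; _++_; length; map; filter; mapMaybe; allFin; upTo; cartesianProduct)
open import Data.List.Extrema.Nat using (argmax-sel)
open import Data.List.Membership.Propositional using (_∈_)
open import Data.List.Membership.Propositional.Properties using (∈-∃++; ∈-map⁺; ∈-map⁻; ∈-filter⁺; ∈-filter⁻; ∈-allFin; ∈-upTo⁺; ∈-cartesianProduct⁺)
open import Data.List.Properties using (length-map; length-++; length-filter; length-tabulate; length-upTo; upTo-∷ʳ; map-∘; map-++; ++-identityʳ)
open import Data.List.Relation.Binary.Permutation.Propositional using (_↭_; ↭-refl; ↭-trans; prep)
open import Data.List.Relation.Binary.Permutation.Propositional.Properties using (shift; ↭-length; ∈-resp-↭) renaming (map⁺ to ↭-map)
open import Data.List.Relation.Unary.All as All using (All; []; _∷_)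
open import Data.List.Relation.Unary.AllPairs using ([]; _∷_)
open import Data.List.Relation.Unary.Any using (here; there)
open import Data.List.Relation.Unary.Unique.Propositional using (Unique)
import Data.List.Relation.Unary.Unique.Propositional.Properties as Unique
open import Data.Maybe using (just; nothing)
open import Data.Nat using (ℕ; zero; suc; pred; _+_; _*_; _∸_; _≤_; _<_; _≤?_; _<?_; _≟_; z≤n; s≤s; s≤s⁻¹; z<s; >-nonZero)
open import Data.Nat.ListAction using (sum)
open import Data.Nat.ListAction.Properties using (sum-↭; sum-++)
open import Data.Nat.Properties hiding (_≟_; _≤?_; _<?_)
open import Data.Nat.Tactic.RingSolver using (solve-∀)
open import Data.Product using (∃-syntax; _×_; _,_; proj₁; proj₂)
open import Data.Sum using (_⊎_; inj₁; inj₂)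
open import Function using (_∘_; id; case_of_)
open import Function.Bundles using (mk⤖)
open import Relation.Binary.Definitions using (tri<; tri≈; tri>)
open import Relation.Binary.PropositionalEquality using (_≡_; _≢_; refl; sym; trans; cong; cong₂; subst; module ≡-Reasoning)
open import Relation.Nullary using (¬_; Dec; yes; no; contradiction)
open import Relation.Nullary.Decidable using (¬?)
open import Relation.Unary using (Decidable)

-- Lists without repetitions

∑ : {A : Set} → (A → ℕ) → List A → ℕ
∑ f xs = sum (map f xs)

module _ {A : Set} where

  ∑-↭ : (f : A → ℕ) {xs ys : List A} → xs ↭ ys → ∑ f xs ≡ ∑ f ys
  ∑-↭ f p = sum-↭ (↭-map f p)

  ∑-++ : (f : A → ℕ) (xs ys : List A) → ∑ f (xs ++ ys) ≡ ∑ f xs + ∑ f ys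
  ∑-++ f xs ys = trans (cong sum (map-++ f xs ys)) (sum-++ (map f xs) (map f ys))

  ∑-mono : {f g : A → ℕ} (xs : List A) → (∀ {x} → x ∈ xs → f x ≤ g x) → ∑ f xs ≤ ∑ g xs
  ∑-mono []       f≤g = z≤n
  ∑-mono (x ∷ xs) f≤g = +-mono-≤ (f≤g (here refl)) (∑-mono xs (f≤g ∘ there))

  ∑-const : (c : ℕ) (xs : List A) → ∑ (λ _ → c) xs ≡ c * length xs
  ∑-const c []       = sym (*-zeroʳ c)
  ∑-const c (x ∷ xs) = trans (cong (c +_) (∑-const c xs)) (sym (*-suc c (length xs)))

  ∑-lower : (f : A → ℕ) (c : ℕ) (xs : List A) → (∀ {x} → x ∈ xs → c ≤ f x) → c * length xs ≤ ∑ f xs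
  ∑-lower f c xs c≤f = subst (_≤ ∑ f xs) (∑-const c xs) (∑-mono xs c≤f)

  ∑-upper : (f : A → ℕ) (c : ℕ) (xs : List A) → (∀ {x} → x ∈ xs → f x ≤ c) → ∑ f xs ≤ c * length xs
  ∑-upper f c xs f≤c = subst (∑ f xs ≤_) (∑-const c xs) (∑-mono xs f≤c)

  ∑-cong : {f g : A → ℕ} (xs : List A) → (∀ {x} → x ∈ xs → f x ≡ g x) → ∑ f xs ≡ ∑ g xs
  ∑-cong xs eq = ≤-antisym (∑-mono xs (≤-reflexive ∘ eq)) (∑-mono xs (≤-reflexive ∘ sym ∘ eq))

  module _ {P : A → Set} (P? : Decidable P) where

    ∑-filter : (f : A → ℕ) (xs : List A) → ∑ f (filter P? xs) + ∑ f (filter (¬? ∘ P?) xs) ≡ ∑ f xs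
    ∑-filter f []       = refl
    ∑-filter f (x ∷ xs) with P? x
    ... | yes _ = trans (+-assoc (f x) _ _) (cong (f x +_) (∑-filter f xs))
    ... | no  _ = trans (lemma (∑ f (filter P? xs)) (f x) _) (cong (f x +_) (∑-filter f xs))
      where
      lemma : ∀ a b c → a + (b + c) ≡ b + (a + c)
      lemma = solve-∀

    length-filter-¬ : (xs : List A) → length (filter P? xs) + length (filter (¬? ∘ P?) xs) ≡ length xs
    length-filter-¬ []       = refl
    length-filter-¬ (x ∷ xs) with P? x
    ... | yes _ = cong suc (length-filter-¬ xs)
    ... | no  _ = trans (+-suc (length (filter P? xs)) _) (cong suc (length-filter-¬ xs))

  ∈⇒↭ : {x : A} {xs : List A} → x ∈ xs → ∃[ ys ] xs ↭ x ∷ ys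
  ∈⇒↭ x∈xs with ∈-∃++ x∈xs
  ... | as , bs , refl = as ++ bs , shift _ as bs

  -- Each element of `xs` is pulled to the front of `ys` in turn; the later ones stay in the
  -- remainder because they differ from it. Comparisons of lengths and of sums both follow from
  -- this.
  unique-⊆⇒↭ : {xs ys : List A} → Unique xs → (∀ {x} → x ∈ xs → x ∈ ys) → ∃[ zs ] ys ↭ xs ++ zs
  unique-⊆⇒↭ {[]}     {ys} _            _     = ys , ↭-refl
  unique-⊆⇒↭ {x ∷ xs} {ys} (x∉xs ∷ uxs) xs⊆ys with ∈⇒↭ (xs⊆ys (here refl))
  ... | ys′ , ys↭ with unique-⊆⇒↭ uxs xs⊆ys′
    where
    xs⊆ys′ : ∀ {z} → z ∈ xs → z ∈ ys′
    xs⊆ys′ z∈xs with ∈-resp-↭ ys↭ (xs⊆ys (there z∈xs))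
    ... | here refl  = contradiction refl (All.lookup x∉xs z∈xs)
    ... | there z∈ys = z∈ys
  ... | zs , ys′↭ = zs , ↭-trans ys↭ (prep x ys′↭)

  length-⊆ : {xs ys : List A} → Unique xs → (∀ {x} → x ∈ xs → x ∈ ys) → length xs ≤ length ys
  length-⊆ {xs} uxs xs⊆ys with unique-⊆⇒↭ uxs xs⊆ys
  ... | zs , ys↭ = subst (length xs ≤_) (sym (trans (↭-length ys↭) (length-++ xs))) (m≤m+n _ _)

  ∑-⊆ : (f : A → ℕ) {xs ys : List A} → Unique xs → (∀ {x} → x ∈ xs → x ∈ ys) → ∑ f xs ≤ ∑ f ys
  ∑-⊆ f {xs} uxs xs⊆ys with unique-⊆⇒↭ uxs xs⊆ys
  ... | zs , ys↭ = subst (∑ f xs ≤_) (sym (trans (∑-↭ f ys↭) (∑-++ f xs zs))) (m≤m+n _ _)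

  unique-singleton : {x : A} {xs : List A} → Unique xs → x ∈ xs → (∀ {y} → y ∈ xs → y ≡ x) → xs ≡ x ∷ []
  unique-singleton {xs = y ∷ []}     _              _ all = cong (_∷ []) (all (here refl))
  unique-singleton {xs = y ∷ z ∷ xs} ((y≢z ∷ _) ∷ _) _ all =
    contradiction (trans (all (here refl)) (sym (all (there (here refl))))) y≢z

  unique-map : {B : Set} (f : A → B) {xs : List A} → Unique xs →
               (∀ {x y} → x ∈ xs → y ∈ xs → f x ≡ f y → x ≡ y) → Unique (map f xs)
  unique-map f {[]}     _            _   = []
  unique-map f {x ∷ xs} (x∉xs ∷ uxs) inj =
    All.tabulate (λ fy∈ fx≡ → case ∈-map⁻ f fy∈ of λ where
      (y , y∈ , eq) → All.lookup x∉xs y∈ (inj (here refl) (there y∈) (trans fx≡ eq)))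
    ∷ unique-map f uxs (λ x∈ y∈ → inj (there x∈) (there y∈))

-- Pigeonhole principle: comparing lengths, the part of `upTo L` outside `xs` is empty.
unique-bounded⇒↭-upTo : {L : ℕ} {xs : List ℕ} → Unique xs → (∀ {x} → x ∈ xs → x < L) → length xs ≡ L → upTo L ↭ xs
unique-bounded⇒↭-upTo {L} {xs} uxs xs<L len with unique-⊆⇒↭ {ys = upTo L} uxs (∈-upTo⁺ ∘ xs<L)
... | zs , up↭ = subst (upTo L ↭_) (trans (cong (xs ++_) (empty zs no-more)) (++-identityʳ xs)) up↭
  where
  no-more : length zs ≡ 0
  no-more = +-cancelˡ-≡ (length xs) (length zs) 0 (begin
    length xs + length zs ≡⟨ length-++ xs ⟨
    length (xs ++ zs)     ≡⟨ ↭-length up↭ ⟨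
    length (upTo L)       ≡⟨ length-upTo L ⟩
    L                     ≡⟨ len ⟨
    length xs             ≡⟨ +-identityʳ _ ⟨
    length xs + 0         ∎)
    where open ≡-Reasoning
  empty : (zs : List ℕ) → length zs ≡ 0 → zs ≡ []
  empty [] _ = refl

-- Positions in the order given by an injective key

module Rank {A : Set} (xs : List A) (unique : Unique xs) (key : A → ℕ)
            (key-injective : ∀ {x y} → key x ≡ key y → x ≡ y) where

  -- For `x` in `xs` this is its position, counted from 0, once `xs` is sorted by `key`; counting
  -- smaller keys avoids building a sorted list.
  rank : A → ℕ
  rank x = length (filter (λ y → key y <? key x) xs)

  private
    -- As `rank x` does not count `x` itself, adding `x` creates no repetition, and strict bounds on
    -- ranks become inclusions of lists.
    insert : ∀ x → Unique (x ∷ filter (λ y → key y <? key x) xs)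
    insert x = All.tabulate (λ y∈ → λ where
      refl → <-irrefl refl (proj₂ (∈-filter⁻ (λ y → key y <? key x) {xs = xs} y∈)))
      ∷ Unique.filter⁺ (λ y → key y <? key x) unique

  rank-< : ∀ {x} → x ∈ xs → rank x < length xs
  rank-< {x} x∈ = length-⊆ (insert x) λ where
    (here refl) → x∈
    (there y∈)  → proj₁ (∈-filter⁻ (λ y → key y <? key x) {xs = xs} y∈)

  rank-mono : ∀ {x y} → x ∈ xs → key x < key y → rank x < rank y
  rank-mono {x} {y} x∈ x<y = length-⊆ (insert x) λ where
    (here refl) → ∈-filter⁺ (λ z → key z <? key y) x∈ x<y
    (there z∈)  → let z∈xs , z<x = ∈-filter⁻ (λ z → key z <? key x) {xs = xs} z∈
                  in ∈-filter⁺ (λ z → key z <? key y) z∈xs (<-trans z<x x<y)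

  rank-injective : ∀ {x y} → x ∈ xs → y ∈ xs → rank x ≡ rank y → x ≡ y
  rank-injective {x} {y} x∈ y∈ eq with <-cmp (key x) (key y)
  ... | tri< x<y _ _ = contradiction eq (<⇒≢ (rank-mono x∈ x<y))
  ... | tri≈ _ x≈y _ = key-injective x≈y
  ... | tri> _ _ y<x = contradiction (sym eq) (<⇒≢ (rank-mono y∈ y<x))

  -- Whatever `rank x` does not count has a key of at least `key x`. This bounds ranks from below,
  -- showing that certain elements come near the end of the order.
  length≤rank+above : ∀ x ys → (∀ {y} → y ∈ xs → key x ≤ key y → y ∈ ys) → length xs ≤ rank x + length ys
  length≤rank+above x ys above = begin
    length xs                                                   ≡⟨ length-filter-¬ (λ y → key y <? key x) xs ⟨
    rank x + length (filter (λ y → ¬? (key y <? key x)) xs)     ≤⟨ +-monoʳ-≤ (rank x) (length-⊆ (Unique.filter⁺ _ unique) λ y∈ →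
      let y∈xs , y≮x = ∈-filter⁻ (λ y → ¬? (key y <? key x)) {xs = xs} y∈ in above y∈xs (≮⇒≥ y≮x)) ⟩
    rank x + length ys                                          ∎
    where open ≤-Reasoning

  -- The ranks run through 0, ..., `length xs` - 1, each exactly once.
  ∑-rank : (f : ℕ → ℕ) → ∑ (f ∘ rank) xs ≡ ∑ f (upTo (length xs))
  ∑-rank f = trans (cong sum (map-∘ xs)) (sym (∑-↭ f (unique-bounded⇒↭-upTo
    (unique-map rank unique rank-injective)
    (λ r∈ → case ∈-map⁻ rank r∈ of λ where (x , x∈ , refl) → rank-< x∈)
    (length-map rank xs))))

-- Edges

module _ {n : ℕ} {G : Graph n} where
  open Graph G

  edge-≡ : {e e′ : Edge G} → Edge.i e ≡ Edge.i e′ → Edge.j e ≡ Edge.j e′ → e ≡ e′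
  edge-≡ {mkEdge i j p a} {mkEdge .i .j q b} refl refl
    rewrite ≤-irrelevant p q | T-irrelevant {adj i j} a b = refl

  toEdge-just : ∀ p {e} → toEdge G p ≡ just e → p ≡ (Edge.i e , Edge.j e)
  toEdge-just (i , j) eq with i Finₚ.<? j | T? (adj i j)
  toEdge-just (i , j) refl | yes _ | yes _ = refl

  toEdge-edge : ∀ e → toEdge G (Edge.i e , Edge.j e) ≡ just e
  toEdge-edge (mkEdge i j p a) with i Finₚ.<? j | T? (adj i j)
  ... | yes _ | yes _ = cong just (edge-≡ refl refl)
  ... | yes _ | no ¬a = contradiction a ¬a
  ... | no ¬p | _     = contradiction p ¬p

  private
    ∈-mapMaybe⁻ : ∀ ps {e} → e ∈ mapMaybe (toEdge G) ps → (Edge.i e , Edge.j e) ∈ ps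
    ∈-mapMaybe⁻ (p ∷ ps) e∈ with toEdge G p in eq
    ∈-mapMaybe⁻ (p ∷ ps) (here refl) | just e = here (sym (toEdge-just p eq))
    ∈-mapMaybe⁻ (p ∷ ps) (there e∈)  | just _ = there (∈-mapMaybe⁻ ps e∈)
    ∈-mapMaybe⁻ (p ∷ ps) e∈          | nothing = there (∈-mapMaybe⁻ ps e∈)

    ∈-mapMaybe⁺ : ∀ ps {e} → (Edge.i e , Edge.j e) ∈ ps → e ∈ mapMaybe (toEdge G) ps
    ∈-mapMaybe⁺ (p ∷ ps) {e} (here refl) rewrite toEdge-edge e = here refl
    ∈-mapMaybe⁺ (p ∷ ps) (there e∈) with toEdge G p
    ... | just _  = there (∈-mapMaybe⁺ ps e∈)
    ... | nothing = ∈-mapMaybe⁺ ps e∈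

    unique-mapMaybe : ∀ {ps} → Unique ps → Unique (mapMaybe (toEdge G) ps)
    unique-mapMaybe {[]}     _            = []
    unique-mapMaybe {p ∷ ps} (p∉ps ∷ ups) with toEdge G p in eq
    ... | nothing = unique-mapMaybe ups
    ... | just e  = All.tabulate (λ where
        e∈ refl → All.lookup p∉ps (∈-mapMaybe⁻ ps e∈) (toEdge-just p eq))
      ∷ unique-mapMaybe ups

  ∈-edges : ∀ e → e ∈ edges G
  ∈-edges e = ∈-mapMaybe⁺ (cartesianProduct (allFin n) (allFin n)) (∈-cartesianProduct⁺ (∈-allFin _) (∈-allFin _))

  edges-unique : Unique (edges G)
  edges-unique = unique-mapMaybe (Unique.cartesianProduct⁺ (Unique.allFin⁺ n) (Unique.allFin⁺ n))

  endpoints-determine : ∀ {x y e e′} → x ≢ y → Incident G x e → Incident G y e →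
                        Incident G x e′ → Incident G y e′ → e ≡ e′
  endpoints-determine x≢y (inj₁ refl) (inj₁ refl) _ _ = contradiction refl x≢y
  endpoints-determine x≢y (inj₂ refl) (inj₂ refl) _ _ = contradiction refl x≢y
  endpoints-determine x≢y _ _ (inj₁ refl) (inj₁ refl) = contradiction refl x≢y
  endpoints-determine x≢y _ _ (inj₂ refl) (inj₂ refl) = contradiction refl x≢y
  endpoints-determine x≢y (inj₁ refl) (inj₂ refl) (inj₁ p) (inj₂ q) = edge-≡ p q
  endpoints-determine x≢y (inj₂ refl) (inj₁ refl) (inj₂ p) (inj₁ q) = edge-≡ q p
  -- From here on the two edges would list the same ends in opposite orders, against `i < j`.
  endpoints-determine {e = e} {e′} x≢y (inj₁ refl) (inj₂ refl) (inj₂ refl) (inj₁ refl) =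
    contradiction (Edge.i<j e) (<-asym (Edge.i<j e′))
  endpoints-determine {e = e} {e′} x≢y (inj₂ refl) (inj₁ refl) (inj₁ refl) (inj₂ refl) =
    contradiction (Edge.i<j e) (<-asym (Edge.i<j e′))

  edge-between : ∀ {x y} → T (adj x y) → ∃[ e ] (Incident G x e × Incident G y e)
  edge-between {x} {y} a with Finₚ.<-cmp x y
  ... | tri< x<y _ _ = mkEdge x y x<y a , inj₁ refl , inj₂ refl
  ... | tri≈ _ refl _ = ⊥-elim (subst T (irrefl x) a)
  ... | tri> _ _ y<x = mkEdge y x y<x (subst T (symm x y) a) , inj₂ refl , inj₁ refl

  edge-adjacent : ∀ {x y e} → x ≢ y → Incident G x e → Incident G y e → T (adj x y)
  edge-adjacent x≢y (inj₁ refl) (inj₁ refl) = contradiction refl x≢y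
  edge-adjacent x≢y (inj₂ refl) (inj₂ refl) = contradiction refl x≢y
  edge-adjacent {e = e} x≢y (inj₁ refl) (inj₂ refl) = Edge.adjacent e
  edge-adjacent {e = e} x≢y (inj₂ refl) (inj₁ refl) = subst T (symm _ _) (Edge.adjacent e)

  module _ (g : Edge G → ℕ) (g-injective : ∀ {e e′} → g e ≡ g e′ → e ≡ e′)
           (0<g : ∀ e → 0 < g e) (g≤m : ∀ e → g e ≤ ∣E∣ G) where

    private
      suc-pred′ : ∀ e → suc (pred (g e)) ≡ g e
      suc-pred′ e with g e | 0<g e
      ... | suc _ | _ = refl

      pred-< : ∀ e → pred (g e) < ∣E∣ G
      pred-< e = subst (_≤ ∣E∣ G) (sym (suc-pred′ e)) (g≤m e)

      pred-injective′ : ∀ {e e′} → pred (g e) ≡ pred (g e′) → e ≡ e′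
      pred-injective′ {e} {e′} eq = g-injective (trans (sym (suc-pred′ e)) (trans (cong suc eq) (suc-pred′ e′)))

      labels↭ : upTo (∣E∣ G) ↭ map (pred ∘ g) (edges G)
      labels↭ = unique-bounded⇒↭-upTo (Unique.map⁺ pred-injective′ edges-unique)
        (λ l∈ → case ∈-map⁻ (pred ∘ g) l∈ of λ where (e , _ , refl) → pred-< e)
        (length-map (pred ∘ g) (edges G))

      to : Edge G → Fin (∣E∣ G)
      to e = fromℕ< (pred-< e)

      to-surjective : ∀ l → ∃[ e ] (∀ {e′} → e′ ≡ e → to e′ ≡ l)
      to-surjective l with ∈-map⁻ (pred ∘ g) (∈-resp-↭ labels↭ (∈-upTo⁺ (Finₚ.toℕ<n l)))
      ... | e , _ , eq = e , λ where refl → Finₚ.toℕ-injective (trans (Finₚ.toℕ-fromℕ< (pred-< e)) (sym eq))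

    ∑-labels : ∑ g (edges G) ≡ ∑ suc (upTo (∣E∣ G))
    ∑-labels = begin
      ∑ g (edges G)                      ≡⟨ ∑-cong (edges G) (λ {e} _ → sym (suc-pred′ e)) ⟩
      ∑ (suc ∘ pred ∘ g) (edges G)       ≡⟨ cong sum (map-∘ (edges G)) ⟩
      ∑ suc (map (pred ∘ g) (edges G))   ≡⟨ ∑-↭ suc labels↭ ⟨
      ∑ suc (upTo (∣E∣ G))               ∎
      where open ≡-Reasoning

    -- An injective map from the m edges into 1, ..., m is a bijection by the pigeonhole principle,
    -- so surjectivity need not be checked for each labeling. Passing to `Fin` shifts the labels
    -- down by one.
    antimagic-from-labels : (∀ {x y} → ∑ g (filter (incident? G x) (edges G)) ≡ ∑ g (filter (incident? G y) (edges G)) → x ≡ y) → Antimagic G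
    antimagic-from-labels distinct = f , λ eq → distinct (trans (sym (label-sum _)) (trans eq (label-sum _)))
      where
      f : Labeling G
      f = mk⤖ ((λ {e} {e′} eq → pred-injective′ (Finₚ.fromℕ<-injective _ _ (pred-< e) (pred-< e′) eq)) , to-surjective)
      label-sum : ∀ x → vertexSum G f x ≡ ∑ g (filter (incident? G x) (edges G))
      label-sum x = ∑-cong (filter (incident? G x) (edges G)) λ {e} _ →
        trans (cong suc (Finₚ.toℕ-fromℕ< (pred-< e))) (suc-pred′ e)

-- Labelings around a vertex v with a unique non-neighbour u

filter-comm : {A : Set} {P Q : A → Set} (P? : Decidable P) (Q? : Decidable Q) (xs : List A) →
              filter P? (filter Q? xs) ≡ filter Q? (filter P? xs)
filter-comm P? Q? []       = refl
filter-comm P? Q? (x ∷ xs) with P? x in eqP | Q? x in eqQ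
... | yes _ | yes _ rewrite eqP | eqQ = cong (x ∷_) (filter-comm P? Q? xs)
... | yes _ | no  _ rewrite eqQ = filter-comm P? Q? xs
... | no  _ | yes _ rewrite eqP = filter-comm P? Q? xs
... | no  _ | no  _ = filter-comm P? Q? xs

-- Each `x` is one row of the incidence table; `split` takes a new row out of the sum over columns.
double-counting : {A B : Set} {R : A → B → Set} (R? : ∀ x y → Dec (R x y)) (ys : List B) (xs : List A) →
                  ∑ (λ y → length (filter (λ x → R? x y) xs)) ys ≡ ∑ (λ x → length (filter (R? x) ys)) xs
double-counting R? ys []       = ∑-const 0 ys
double-counting R? ys (x ∷ xs) = trans (split ys) (cong (length (filter (R? x) ys) +_) (double-counting R? ys xs))
  where
  col : _ → ℕ
  col y = length (filter (λ x → R? x y) xs)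
  swap₃ : ∀ a b c → a + (b + c) ≡ b + (a + c)
  swap₃ = solve-∀
  split : ∀ ys → ∑ (λ y → length (filter (λ x → R? x y) (x ∷ xs))) ys
        ≡ length (filter (R? x) ys) + ∑ (λ y → length (filter (λ x → R? x y) xs)) ys
  split []       = refl
  split (y ∷ ys) with R? x y
  ... | yes _ = cong suc (trans (cong (col y +_) (split ys)) (swap₃ (col y) (length (filter (R? x) ys)) (∑ col ys)))
  ... | no  _ = trans (cong (col y +_) (split ys)) (swap₃ (col y) (length (filter (R? x) ys)) (∑ col ys))

module Center {n : ℕ} (G : Graph n) (v u : Fin n) (u≢v : u ≢ v) (u-far : ¬ T (Graph.adj G v u))
              (others-near : ∀ x → x ≢ v → x ≢ u → T (Graph.adj G v x)) where
  open Graph G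

  near : List (Fin n)
  near = filter (λ x → T? (adj v x)) (allFin n)

  near-unique : Unique near
  near-unique = Unique.filter⁺ _ (Unique.allFin⁺ n)

  ∈-near⁺ : ∀ {x} → T (adj v x) → x ∈ near
  ∈-near⁺ = ∈-filter⁺ (λ x → T? (adj v x)) (∈-allFin _)

  ∈-near⁻ : ∀ {x} → x ∈ near → T (adj v x)
  ∈-near⁻ x∈ = proj₂ (∈-filter⁻ (λ x → T? (adj v x)) {xs = allFin n} x∈)

  near⇒≢v : ∀ {x} → x ∈ near → x ≢ v
  near⇒≢v x∈ refl = subst T (irrefl v) (∈-near⁻ x∈)

  near⇒≢u : ∀ {x} → x ∈ near → x ≢ u
  near⇒≢u x∈ refl = u-far (∈-near⁻ x∈)

  H : List (Edge G)
  H = filter (λ e → ¬? (incident? G v e)) (edges G)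

  H-unique : Unique H
  H-unique = Unique.filter⁺ _ edges-unique

  ∈-H⁺ : ∀ {e} → ¬ Incident G v e → e ∈ H
  ∈-H⁺ = ∈-filter⁺ (λ e → ¬? (incident? G v e)) (∈-edges _)

  ∈-H⁻ : ∀ {e} → e ∈ H → ¬ Incident G v e
  ∈-H⁻ e∈ = proj₂ (∈-filter⁻ (λ e → ¬? (incident? G v e)) {xs = edges G} e∈)

  k : ℕ
  k = length H

  H-at : Fin n → List (Edge G)
  H-at x = filter (incident? G x) H

  H-off : Fin n → List (Edge G)
  H-off x = filter (λ e → ¬? (incident? G x e)) H

  deg : Fin n → ℕ
  deg x = length (H-at x)

  deg≤k : ∀ x → deg x ≤ k
  deg≤k x = length-filter (incident? G x) H

  -- Each edge of `H` has at most two ends in `xs`. It is an inequality because `xs` may miss some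
  -- of them.
  handshake : ∀ {xs} → Unique xs → ∑ deg xs ≤ 2 * k
  handshake {xs} uxs = subst (_≤ 2 * k) (double-counting (incident? G) H xs) (∑-upper _ 2 H λ {e} _ →
    length-⊆ {ys = Edge.i e ∷ Edge.j e ∷ []} (Unique.filter⁺ (λ x → incident? G x e) uxs) λ x∈ →
      case proj₂ (∈-filter⁻ (λ x → incident? G x e) {xs = xs} x∈) of λ where
        (inj₁ eq) → here eq
        (inj₂ eq) → there (here eq))

  -- Meant for edges at `v`, where it is the end different from `v`; on `H` the value carries no
  -- meaning.
  other : Edge G → Fin n
  other e with v Finₚ.≟ Edge.i e
  ... | yes _ = Edge.j e
  ... | no  _ = Edge.i e

  other-incident : ∀ e → Incident G (other e) e
  other-incident e with v Finₚ.≟ Edge.i e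
  ... | yes _ = inj₂ refl
  ... | no  _ = inj₁ refl

  other≢v : ∀ e → v ≢ other e
  other≢v e eq with v Finₚ.≟ Edge.i e
  ... | yes refl = <-irrefl (cong toℕ eq) (Edge.i<j e)
  ... | no v≢i   = v≢i eq

  other-unique : ∀ {x e} → x ≢ v → Incident G v e → Incident G x e → other e ≡ x
  other-unique {e = e} x≢v v∈e x∈e with v Finₚ.≟ Edge.i e
  other-unique x≢v v∈e (inj₁ refl) | yes v≡ = contradiction (sym v≡) x≢v
  other-unique x≢v v∈e (inj₂ refl) | yes v≡ = refl
  other-unique x≢v v∈e (inj₁ refl) | no _   = refl
  other-unique x≢v (inj₁ v≡) (inj₂ refl) | no v≢i = contradiction v≡ v≢i
  other-unique x≢v (inj₂ v≡) (inj₂ refl) | no _   = contradiction (sym v≡) x≢v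

  other∈near : ∀ {e} → Incident G v e → other e ∈ near
  other∈near {e} v∈e = ∈-near⁺ (edge-adjacent {G = G} {e = e} (other≢v e) v∈e (other-incident e))

  other-injective : ∀ {e e′} → Incident G v e → Incident G v e′ → other e ≡ other e′ → e ≡ e′
  other-injective {e} {e′} v∈e v∈e′ eq = endpoints-determine (other≢v e) v∈e (other-incident e) v∈e′
    (subst (λ x → Incident G x e′) (sym eq) (other-incident e′))

  -- `other` matches the edges at `v` with the neighbours of `v`: its injectivity gives one
  -- inequality, `edge-between` the other.
  ∣E∣≡ : ∣E∣ G ≡ length near + k
  ∣E∣≡ = trans (sym (length-filter-¬ (incident? G v) (edges G))) (cong (_+ k) (≤-antisym
    (subst (_≤ length near) (length-map other star) (length-⊆
      (unique-map other (Unique.filter⁺ (incident? G v) edges-unique) λ e∈ e′∈ → other-injective (star⇒ e∈) (star⇒ e′∈))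
      λ x∈ → case ∈-map⁻ other x∈ of λ where (e , e∈ , refl) → other∈near (star⇒ e∈)))
    (subst (length near ≤_) (length-map other star) (length-⊆ near-unique λ x∈ →
      let e , v∈e , x∈e = edge-between (∈-near⁻ x∈) in
      subst (_∈ map other star) (other-unique (near⇒≢v x∈) v∈e x∈e)
        (∈-map⁺ other (∈-filter⁺ (incident? G v) (∈-edges e) v∈e))))))
    where
    star : List (Edge G)
    star = filter (incident? G v) (edges G)
    star⇒ : ∀ {e} → e ∈ star → Incident G v e
    star⇒ e∈ = proj₂ (∈-filter⁻ (incident? G v) {xs = edges G} e∈)

  vertex-cases : ∀ x → x ≡ v ⊎ x ≡ u ⊎ x ∈ near
  vertex-cases x with x Finₚ.≟ v | x Finₚ.≟ u
  ... | yes x≡v | _       = inj₁ x≡v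
  ... | no  _   | yes x≡u = inj₂ (inj₁ x≡u)
  ... | no x≢v  | no x≢u  = inj₂ (inj₂ (∈-near⁺ (others-near x x≢v x≢u)))

  -- `τ` lists the labels of `H` and `σ` those of the edges at `v`, each in increasing order. `keyᴴ`
  -- orders the edges of `H`; the neighbours of `v` are then ordered by their partial sums.
  module Labels
    (keyᴴ : Edge G → ℕ) (keyᴴ-injective : ∀ {e e′} → keyᴴ e ≡ keyᴴ e′ → e ≡ e′)
    (σ τ : ℕ → ℕ) (σ-mono : ∀ {p q} → p < q → σ p < σ q) (τ-mono : ∀ {p q} → p < q → τ p < τ q)
    (0<σ : ∀ q → 0 < σ q) (0<τ : ∀ q → 0 < τ q)
    (σ≢τ : ∀ {p q} → p < length near → q < k → σ p ≢ τ q)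
    (σ≤m : ∀ {q} → q < length near → σ q ≤ ∣E∣ G) (τ≤m : ∀ {q} → q < k → τ q ≤ ∣E∣ G)
    where

    open Rank H H-unique keyᴴ keyᴴ-injective public
      using () renaming (rank to rankᴴ; rank-< to rankᴴ-<; rank-injective to rankᴴ-injective; length≤rank+above to k≤rankᴴ+above; ∑-rank to ∑-rankᴴ)

    h : Edge G → ℕ
    h e = τ (rankᴴ e)

    partial : Fin n → ℕ
    partial x = ∑ h (H-at x)

    -- Lexicographic order coded as one number: since `toℕ x` is below `n`, the vertex number only
    -- breaks ties between equal partial sums.
    keyⱽ : Fin n → ℕ
    keyⱽ x = partial x * n + toℕ x

    partial<⇒keyⱽ< : ∀ {x y} → partial x < partial y → keyⱽ x < keyⱽ y
    partial<⇒keyⱽ< {x} {y} lt = begin-strict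
      partial x * n + toℕ x   <⟨ +-monoʳ-< (partial x * n) (Finₚ.toℕ<n x) ⟩
      partial x * n + n       ≡⟨ +-comm (partial x * n) n ⟩
      suc (partial x) * n     ≤⟨ *-monoˡ-≤ n lt ⟩
      partial y * n           ≤⟨ m≤m+n _ _ ⟩
      partial y * n + toℕ y   ∎
      where open ≤-Reasoning

    keyⱽ-injective : ∀ {x y} → keyⱽ x ≡ keyⱽ y → x ≡ y
    keyⱽ-injective {x} {y} eq with <-cmp (partial x) (partial y)
    ... | tri< lt _ _ = contradiction eq (<⇒≢ (partial<⇒keyⱽ< lt))
    ... | tri> _ _ gt = contradiction (sym eq) (<⇒≢ (partial<⇒keyⱽ< gt))
    ... | tri≈ _ px≡py _ = Finₚ.toℕ-injective (+-cancelˡ-≡ (partial x * n) _ _ (trans eq (cong (λ p → p * n + toℕ y) (sym px≡py))))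

    open Rank near near-unique keyⱽ keyⱽ-injective public
      using (rank; rank-<; rank-mono; rank-injective; length≤rank+above)

    near≤rank+above : ∀ x ys → (∀ {y} → y ∈ near → partial x ≤ partial y → y ∈ ys) → length near ≤ rank x + length ys
    near≤rank+above x ys above = length≤rank+above x ys λ y∈ key≤ →
      above y∈ (≮⇒≥ λ lt → <⇒≱ (partial<⇒keyⱽ< lt) key≤)

    total : Fin n → ℕ
    total x = partial x + σ (rank x)

    -- A later neighbour has at least as large a partial sum and a strictly larger label at `v`.
    -- This separates the neighbours of `v` from one another.
    total-mono : ∀ {x y} → x ∈ near → keyⱽ x < keyⱽ y → total x < total y
    total-mono x∈ lt = +-mono-≤-< (≮⇒≥ λ gt → <-asym lt (partial<⇒keyⱽ< gt)) (σ-mono (rank-mono x∈ lt))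

    total-injective : ∀ {x y} → x ∈ near → y ∈ near → total x ≡ total y → x ≡ y
    total-injective {x} {y} x∈ y∈ eq with <-cmp (keyⱽ x) (keyⱽ y)
    ... | tri< lt _ _ = contradiction eq (<⇒≢ (total-mono x∈ lt))
    ... | tri≈ _ k≡ _ = keyⱽ-injective k≡
    ... | tri> _ _ gt = contradiction (sym eq) (<⇒≢ (total-mono y∈ gt))

    g : Edge G → ℕ
    g e with incident? G v e
    ... | yes _ = σ (rank (other e))
    ... | no  _ = h e

    g-star : ∀ {e} → Incident G v e → g e ≡ σ (rank (other e))
    g-star {e} v∈e with incident? G v e
    ... | yes _  = refl
    ... | no v∉e = contradiction v∈e v∉e

    g-H : ∀ {e} → ¬ Incident G v e → g e ≡ h e
    g-H {e} v∉e with incident? G v e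
    ... | yes v∈e = contradiction v∈e v∉e
    ... | no  _   = refl

    private
      strict⇒injective : (f : ℕ → ℕ) → (∀ {p q} → p < q → f p < f q) → ∀ {p q} → f p ≡ f q → p ≡ q
      strict⇒injective f mono {p} {q} eq with <-cmp p q
      ... | tri< lt _ _ = contradiction eq (<⇒≢ (mono lt))
      ... | tri≈ _ p≡q _ = p≡q
      ... | tri> _ _ gt = contradiction (sym eq) (<⇒≢ (mono gt))

      g-injective : ∀ {e e′} → g e ≡ g e′ → e ≡ e′
      g-injective {e} {e′} eq with incident? G v e | incident? G v e′
      ... | yes v∈e | yes v∈e′ = other-injective v∈e v∈e′
            (rank-injective (other∈near v∈e) (other∈near v∈e′) (strict⇒injective σ σ-mono eq))
      ... | yes v∈e | no v∉e′  = contradiction eq (σ≢τ (rank-< (other∈near v∈e)) (rankᴴ-< (∈-H⁺ v∉e′)))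
      ... | no v∉e  | yes v∈e′ = contradiction (sym eq) (σ≢τ (rank-< (other∈near v∈e′)) (rankᴴ-< (∈-H⁺ v∉e)))
      ... | no v∉e  | no v∉e′  = rankᴴ-injective (∈-H⁺ v∉e) (∈-H⁺ v∉e′) (strict⇒injective τ τ-mono eq)

      0<g : ∀ e → 0 < g e
      0<g e with incident? G v e
      ... | yes _ = 0<σ _
      ... | no  _ = 0<τ _

      g≤m : ∀ e → g e ≤ ∣E∣ G
      g≤m e with incident? G v e
      ... | yes v∈e = σ≤m (rank-< (other∈near v∈e))
      ... | no v∉e  = τ≤m (rankᴴ-< (∈-H⁺ v∉e))

      sum-at : Fin n → ℕ
      sum-at x = ∑ g (filter (incident? G x) (edges G))

      sum-at-split : ∀ x → sum-at x ≡ ∑ g (filter (incident? G v) (filter (incident? G x) (edges G))) + partial x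
      sum-at-split x = trans (sym (∑-filter (incident? G v) g (filter (incident? G x) (edges G)))) (cong (∑ g (filter (incident? G v) (filter (incident? G x) (edges G))) +_)
        (trans (cong (∑ g) (filter-comm (λ e → ¬? (incident? G v e)) (incident? G x) (edges G)))
               (∑-cong (H-at x) λ e∈ → g-H (∈-H⁻ (proj₁ (∈-filter⁻ (incident? G x) {xs = H} e∈))))))

      ∈-both : ∀ {x e} → e ∈ filter (incident? G v) (filter (incident? G x) (edges G)) → Incident G v e × Incident G x e
      ∈-both {x} e∈ with ∈-filter⁻ (incident? G v) {xs = filter (incident? G x) (edges G)} e∈
      ... | e∈′ , v∈e = v∈e , proj₂ (∈-filter⁻ (incident? G x) {xs = edges G} e∈′)

      sum-at-u : sum-at u ≡ partial u
      sum-at-u = trans (sum-at-split u) (cong (λ es → ∑ g es + partial u) (empty _ λ {e} e∈ →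
        let v∈e , u∈e = ∈-both e∈ in u-far (edge-adjacent {G = G} {e = e} (u≢v ∘ sym) v∈e u∈e)))
        where
        empty : (es : List (Edge G)) → (∀ {e} → e ∈ es → ⊥) → es ≡ []
        empty []       _  = refl
        empty (e ∷ es) ∉ = ⊥-elim (∉ (here refl))

      -- Simplicity of the graph leaves exactly one edge between `x` and `v`, so a single label is
      -- added to the partial sum.
      sum-at-near : ∀ {x} → x ∈ near → sum-at x ≡ total x
      sum-at-near {x} x∈ with edge-between (∈-near⁻ x∈)
      ... | e , v∈e , x∈e = begin
        sum-at x
          ≡⟨ sum-at-split x ⟩
        ∑ g (filter (incident? G v) (filter (incident? G x) (edges G))) + partial x
          ≡⟨ cong (λ es → ∑ g es + partial x) (unique-singleton
               (Unique.filter⁺ _ (Unique.filter⁺ _ edges-unique))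
               (∈-filter⁺ (incident? G v) (∈-filter⁺ (incident? G x) (∈-edges e) x∈e) v∈e)
               (λ e′∈ → let v∈e′ , x∈e′ = ∈-both e′∈ in endpoints-determine (near⇒≢v x∈ ∘ sym) v∈e′ x∈e′ v∈e x∈e)) ⟩
        g e + 0 + partial x
          ≡⟨ cong (_+ partial x) (trans (+-identityʳ (g e)) (trans (g-star v∈e) (cong (σ ∘ rank) (other-unique (near⇒≢v x∈) v∈e x∈e)))) ⟩
        σ (rank x) + partial x
          ≡⟨ +-comm (σ (rank x)) (partial x) ⟩
        total x ∎
        where open ≡-Reasoning

    ∑-h-H : ∑ h H ≡ ∑ τ (upTo k)
    ∑-h-H = ∑-rankᴴ τ

    partial+off : ∀ x → partial x + ∑ h (H-off x) ≡ ∑ τ (upTo k)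
    partial+off x = trans (∑-filter (incident? G x) h H) ∑-h-H

    private
      -- Every edge is either at `v` or in `H`, so both sides add up all labels. The sum at `v` is
      -- handled only through this equation, without subtraction.
      sum-at-v : sum-at v + ∑ τ (upTo k) ≡ ∑ suc (upTo (∣E∣ G))
      sum-at-v = begin
        sum-at v + ∑ τ (upTo k)   ≡⟨ cong (sum-at v +_) ∑-h-H ⟨
        sum-at v + ∑ h H          ≡⟨ cong (sum-at v +_) (∑-cong H (sym ∘ g-H ∘ ∈-H⁻)) ⟩
        sum-at v + ∑ g H          ≡⟨ ∑-filter (incident? G v) g (edges G) ⟩
        ∑ g (edges G)             ≡⟨ ∑-labels g g-injective 0<g g≤m ⟩
        ∑ suc (upTo (∣E∣ G))      ∎
        where open ≡-Reasoning

    -- `total-injective` already separates the neighbours of `v`, which leaves three kinds of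
    -- collision. In those with `v` the label total of `H` is added to both sides, so that
    -- `sum-at-v` applies.
    antimagic : (∀ {x} → x ∈ near → total x ≢ partial u) →
                (∀ {x} → x ∈ near → total x + ∑ τ (upTo k) ≢ ∑ suc (upTo (∣E∣ G))) →
                partial u + ∑ τ (upTo k) ≢ ∑ suc (upTo (∣E∣ G)) → Antimagic G
    antimagic near≢u near≢v u≢v′ = antimagic-from-labels g g-injective 0<g g≤m distinct
      where
      near≢v′ : ∀ {x} → x ∈ near → sum-at x ≢ sum-at v
      near≢v′ x∈ eq = near≢v x∈ (trans (cong (_+ ∑ τ (upTo k)) (trans (sym (sum-at-near x∈)) eq)) sum-at-v)

      near≢u′ : ∀ {x} → x ∈ near → sum-at x ≢ sum-at u
      near≢u′ x∈ eq = near≢u x∈ (trans (sym (sum-at-near x∈)) (trans eq sum-at-u))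

      u≢v″ : sum-at u ≢ sum-at v
      u≢v″ eq = u≢v′ (trans (cong (_+ ∑ τ (upTo k)) (trans (sym sum-at-u) eq)) sum-at-v)

      distinct : ∀ {x y} → sum-at x ≡ sum-at y → x ≡ y
      distinct {x} {y} eq with vertex-cases x | vertex-cases y
      ... | inj₁ refl        | inj₁ refl        = refl
      ... | inj₁ refl        | inj₂ (inj₁ refl) = contradiction (sym eq) u≢v″
      ... | inj₁ refl        | inj₂ (inj₂ y∈)   = contradiction (sym eq) (near≢v′ y∈)
      ... | inj₂ (inj₁ refl) | inj₁ refl        = contradiction eq u≢v″
      ... | inj₂ (inj₁ refl) | inj₂ (inj₁ refl) = refl
      ... | inj₂ (inj₁ refl) | inj₂ (inj₂ y∈)   = contradiction (sym eq) (near≢u′ y∈)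
      ... | inj₂ (inj₂ x∈)   | inj₁ refl        = contradiction eq (near≢v′ x∈)
      ... | inj₂ (inj₂ x∈)   | inj₂ (inj₁ refl) = contradiction eq (near≢u′ x∈)
      ... | inj₂ (inj₂ x∈)   | inj₂ (inj₂ y∈)   = total-injective x∈ y∈ (trans (sym (sum-at-near x∈)) (trans eq (sum-at-near y∈)))

-- The label sequences

∑-upTo-suc : (f : ℕ → ℕ) (k : ℕ) → ∑ f (upTo (suc k)) ≡ ∑ f (upTo k) + f k
∑-upTo-suc f k = begin
  ∑ f (upTo (suc k))         ≡⟨ cong (∑ f) (upTo-∷ʳ k) ⟨
  ∑ f (upTo k ++ k ∷ [])     ≡⟨ ∑-++ f (upTo k) (k ∷ []) ⟩
  ∑ f (upTo k) + (f k + 0)   ≡⟨ cong (∑ f (upTo k) +_) (+-identityʳ (f k)) ⟩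
  ∑ f (upTo k) + f k         ∎
  where open ≡-Reasoning

2*∑-suc : ∀ m → 2 * ∑ suc (upTo m) ≡ m * suc m
2*∑-suc zero    = refl
2*∑-suc (suc m) = begin
  2 * ∑ suc (upTo (suc m))        ≡⟨ cong (2 *_) (∑-upTo-suc suc m) ⟩
  2 * (∑ suc (upTo m) + suc m)    ≡⟨ *-distribˡ-+ 2 (∑ suc (upTo m)) (suc m) ⟩
  2 * ∑ suc (upTo m) + 2 * suc m  ≡⟨ cong (_+ 2 * suc m) (2*∑-suc m) ⟩
  m * suc m + 2 * suc m           ≡⟨ lemma m ⟩
  suc m * suc (suc m)             ∎
  where
  open ≡-Reasoning
  lemma : ∀ m → m * suc m + 2 * suc m ≡ suc m * suc (suc m)
  lemma = solve-∀

-- The even labels 2, …, 2a and 2(a + r) + 2, …, 2(k + r) are left to the edges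
-- avoiding the centre; σ enumerates all other labels in increasing order.
module Sequences (a r : ℕ) where

  τ : ℕ → ℕ
  τ q with q <? a
  ... | yes _ = 2 * suc q
  ... | no  _ = 2 * (suc q + r)

  σ : ℕ → ℕ
  σ q with q <? a | q <? a + 2 * r
  ... | yes _ | _     = suc (2 * q)
  ... | no  _ | yes _ = suc (q + a)
  ... | no  _ | no  _ = suc (2 * (q ∸ r))

  τ-even : ∀ q → ∃[ y ] τ q ≡ 2 * y
  τ-even q with q <? a
  ... | yes _ = suc q , refl
  ... | no  _ = suc q + r , refl

  τ-low : ∀ {q} → q < a → τ q ≡ 2 * suc q
  τ-low {q} q<a with q <? a
  ... | yes _  = refl
  ... | no q≮a = contradiction q<a q≮a

  τ-high : ∀ {q} → a ≤ q → τ q ≡ 2 * (suc q + r)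
  τ-high {q} a≤q with q <? a
  ... | yes q<a = contradiction a≤q (<⇒≱ q<a)
  ... | no _    = refl

  τ-mono : ∀ {p q} → p < q → τ p < τ q
  τ-mono {p} {q} p<q with p <? a | q <? a
  ... | yes _  | yes _   = *-monoʳ-< 2 (s≤s p<q)
  ... | yes _  | no _    = *-monoʳ-< 2 (≤-trans (s≤s p<q) (m≤m+n (suc q) r))
  ... | no p≮a | yes q<a = contradiction (<-trans p<q q<a) p≮a
  ... | no _   | no _    = *-monoʳ-< 2 (+-monoˡ-< r (s≤s p<q))

  2≤τ : ∀ q → 2 ≤ τ q
  2≤τ q with q <? a
  ... | yes _ = *-monoʳ-≤ 2 (s≤s z≤n)
  ... | no  _ = *-monoʳ-≤ 2 (s≤s z≤n)

  τ≤ : ∀ {q} → τ q ≤ 2 * (suc q + r)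
  τ≤ {q} with q <? a
  ... | yes _ = *-monoʳ-≤ 2 (m≤m+n (suc q) r)
  ... | no  _ = ≤-refl

  private
    -- Places the third block of `σ` above the first two.
    r≤high : ∀ {q} → a + 2 * r ≤ q → a + r ≤ q ∸ r
    r≤high {q} le = begin
      a + r            ≡⟨ m+n∸n≡m (a + r) r ⟨
      a + r + r ∸ r    ≡⟨ cong (_∸ r) (lemma a r) ⟩
      a + 2 * r ∸ r    ≤⟨ ∸-monoˡ-≤ r le ⟩
      q ∸ r            ∎
      where
      open ≤-Reasoning
      lemma : ∀ a r → a + r + r ≡ a + 2 * r
      lemma = solve-∀

    double : ∀ x → x + x ≡ 2 * x
    double = solve-∀

  σ-mono : ∀ {p q} → p < q → σ p < σ q
  σ-mono {p} {q} p<q with p <? a | p <? a + 2 * r | q <? a | q <? a + 2 * r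
  ... | yes _   | _        | yes _   | _        = s≤s (*-monoʳ-< 2 p<q)
  ... | yes p<a | _        | no _    | yes _    = s≤s (subst (_< q + a) (double p) (+-mono-< p<q p<a))
  ... | yes p<a | _        | no _    | no q≮    = s≤s (*-monoʳ-< 2 (≤-trans p<a (≤-trans (m≤m+n a r) (r≤high (≮⇒≥ q≮)))))
  ... | no p≮a  | _        | yes q<a | _        = contradiction (<-trans p<q q<a) p≮a
  ... | no _    | yes _    | no _    | yes _    = s≤s (+-monoˡ-< a p<q)
  ... | no _    | yes p<   | no _    | no q≮    = s≤s (begin-strict
      p + a             <⟨ +-monoˡ-< a p< ⟩
      a + 2 * r + a     ≡⟨ lemma a r ⟩
      2 * (a + r)       ≤⟨ *-monoʳ-≤ 2 (r≤high (≮⇒≥ q≮)) ⟩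
      2 * (q ∸ r)       ∎)
    where
    open ≤-Reasoning
    lemma : ∀ a r → a + 2 * r + a ≡ 2 * (a + r)
    lemma = solve-∀
  ... | no _    | no p≮    | no _    | yes q<   = contradiction (<-trans p<q q<) p≮
  ... | no _    | no p≮    | no _    | no _     =
      s≤s (*-monoʳ-< 2 (∸-monoˡ-< p<q (≤-trans (m≤n+m r a) (≤-trans (+-monoʳ-≤ a (m≤m+n r _)) (≮⇒≥ p≮)))))

  0<σ : ∀ q → 0 < σ q
  0<σ q with q <? a | q <? a + 2 * r
  ... | yes _ | _     = z<s
  ... | no  _ | yes _ = z<s
  ... | no  _ | no  _ = z<s

  σ-high : ∀ {q} → a + 2 * r ≤ q → σ q ≡ suc (2 * (q ∸ r))
  σ-high {q} le with q <? a | q <? a + 2 * r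
  ... | yes q<a | _      = contradiction (≤-trans (m≤m+n a _) le) (<⇒≱ q<a)
  ... | no _    | yes q< = contradiction le (<⇒≱ q<)
  ... | no _    | no _   = refl

  -- Even labels of `σ` occur only at these indices, so all of them obey this bound; `σ-high` shows
  -- the remaining labels to be odd.
  σ-low : ∀ {q} → q < a + 2 * r → σ q ≤ 2 * (a + r)
  σ-low {q} q< with q <? a | q <? a + 2 * r
  ... | yes q<a | _     = ≤-trans (*-monoʳ-< 2 q<a) (*-monoʳ-≤ 2 (m≤m+n a r))
  ... | no _    | no q≮ = contradiction q< q≮
  ... | no _    | yes _ = subst (suc (q + a) ≤_) (lemma a r) (+-monoˡ-< a q<)
    where
    lemma : ∀ a r → a + 2 * r + a ≡ 2 * (a + r)
    lemma = solve-∀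

  σ≤ : ∀ {p q} → p ≤ q → a + 2 * r ≤ q → σ p ≤ suc (2 * (q ∸ r))
  σ≤ {p} {q} p≤q le with m≤n⇒m<n∨m≡n p≤q
  ... | inj₁ p<q  = subst (σ p ≤_) (σ-high le) (<⇒≤ (σ-mono p<q))
  ... | inj₂ refl = ≤-reflexive (σ-high le)

  σ≢τ : ∀ p q → σ p ≢ τ q
  σ≢τ p q eq with p <? a | p <? a + 2 * r
  ... | yes _ | _    = even≢odd (proj₁ (τ-even q)) p (trans (sym (proj₂ (τ-even q))) (sym eq))
  ... | no _  | no _ = even≢odd (proj₁ (τ-even q)) (p ∸ r) (trans (sym (proj₂ (τ-even q))) (sym eq))
  -- Parity does not help in the middle block, but its values 2a + 1, ..., 2a + 2r lie strictly
  -- between the two blocks of `τ`.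
  ... | no p≮a | yes p< with q <? a
  ...   | yes q<a = <⇒≢ (s≤s (≤-trans (*-monoʳ-≤ 2 q<a) (subst (_≤ p + a) (double a) (+-monoˡ-≤ a (≮⇒≥ p≮a))))) (sym eq)
  ...   | no q≮a  = <⇒≢ (begin-strict
      suc (p + a)       ≤⟨ +-monoˡ-< a p< ⟩
      a + 2 * r + a     ≡⟨ lemma a r ⟩
      2 * (a + r)       <⟨ *-monoʳ-< 2 (+-monoˡ-< r (s≤s (≮⇒≥ q≮a))) ⟩
      2 * (suc q + r)   ∎) eq
    where
    open ≤-Reasoning
    lemma : ∀ a r → a + 2 * r + a ≡ 2 * (a + r)
    lemma = solve-∀

  ∑-τ-low : ∀ b → b ≤ a → ∑ τ (upTo b) ≡ b * suc b
  ∑-τ-low zero    _   = refl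
  ∑-τ-low (suc b) b<a = begin
    ∑ τ (upTo (suc b))   ≡⟨ ∑-upTo-suc τ b ⟩
    ∑ τ (upTo b) + τ b   ≡⟨ cong₂ _+_ (∑-τ-low b (<⇒≤ b<a)) (τ-low b<a) ⟩
    b * suc b + 2 * suc b   ≡⟨ lemma b ⟩
    suc b * suc (suc b)     ∎
    where
    open ≡-Reasoning
    lemma : ∀ b → b * suc b + 2 * suc b ≡ suc b * suc (suc b)
    lemma = solve-∀

  -- The first a + c even numbers sum to (a + c)(a + c + 1), and each of the last c labels is raised
  -- by 2r.
  ∑-τ : ∀ c → ∑ τ (upTo (a + c)) ≡ (a + c) * suc (a + c) + 2 * r * c
  ∑-τ zero    = begin
    ∑ τ (upTo (a + 0))                     ≡⟨ ∑-τ-low (a + 0) (≤-reflexive (+-identityʳ a)) ⟩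
    (a + 0) * suc (a + 0)                  ≡⟨ +-identityʳ _ ⟨
    (a + 0) * suc (a + 0) + 0              ≡⟨ cong ((a + 0) * suc (a + 0) +_) (*-zeroʳ (2 * r)) ⟨
    (a + 0) * suc (a + 0) + 2 * r * 0      ∎
    where open ≡-Reasoning
  ∑-τ (suc c) = begin
    ∑ τ (upTo (a + suc c))                 ≡⟨ cong (λ b → ∑ τ (upTo b)) (+-suc a c) ⟩
    ∑ τ (upTo (suc (a + c)))               ≡⟨ ∑-upTo-suc τ (a + c) ⟩
    ∑ τ (upTo (a + c)) + τ (a + c)         ≡⟨ cong₂ _+_ (∑-τ c) (τ-high (m≤m+n a c)) ⟩
    (a + c) * suc (a + c) + 2 * r * c + 2 * (suc (a + c) + r)   ≡⟨ lemma a r c ⟩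
    (a + suc c) * suc (a + suc c) + 2 * r * suc c               ∎
    where
    open ≡-Reasoning
    lemma : ∀ a r c → (a + c) * suc (a + c) + 2 * r * c + 2 * (suc (a + c) + r)
                    ≡ (a + suc c) * suc (a + suc c) + 2 * r * suc c
    lemma = solve-∀

-- The three cases

module Cases {n : ℕ} (G : Graph n) (v u : Fin n) (u≢v : u ≢ v) (u-far : ¬ T (Graph.adj G v u))
             (others-near : ∀ x → x ≢ v → x ≢ u → T (Graph.adj G v x)) where
  open Center G v u u≢v u-far others-near

  -- Position of the pair of ends in an n by n table: an injective numbering with values below
  -- `n * n`.
  index : Edge G → ℕ
  index e = toℕ (combine (Edge.i e) (Edge.j e))

  index-injective : ∀ {e e′} → index e ≡ index e′ → e ≡ e′
  index-injective {e} {e′} eq with Finₚ.combine-injective (Edge.i e) (Edge.j e) (Edge.i e′) (Edge.j e′) (Finₚ.toℕ-injective eq)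
  ... | i≡ , j≡ = edge-≡ i≡ j≡

  ∈-H-at⁻ : ∀ {x e} → e ∈ H-at x → e ∈ H × Incident G x e
  ∈-H-at⁻ {x} = ∈-filter⁻ (incident? G x) {xs = H}

  ∈-H-off⁺ : ∀ {x e} → e ∈ H → ¬ Incident G x e → e ∈ H-off x
  ∈-H-off⁺ {x} = ∈-filter⁺ (λ e → ¬? (incident? G x e))

  deg+off : ∀ x → deg x + length (H-off x) ≡ k
  deg+off x = length-filter-¬ (incident? G x) H

  deg<k : ∀ {x e} → e ∈ H → ¬ Incident G x e → deg x < k
  deg<k {x} e∈ x∉e with H-off x | ∈-H-off⁺ e∈ x∉e | deg+off x
  ... | _ ∷ es | _ | eq = subst (suc (deg x) ≤_) (trans (sym (+-suc (deg x) (length es))) eq) (s≤s (m≤m+n (deg x) (length es)))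

  two-edges : 2 ≤ deg u → ∃[ e₁ ] ∃[ e₂ ] (e₁ ≢ e₂ × e₁ ∈ H-at u × e₂ ∈ H-at u)
  two-edges 2≤d with H-at u | Unique.filter⁺ (incident? G u) H-unique
  ... | e₁ ∷ e₂ ∷ _ | (e₁≢e₂ ∷ _) ∷ _ = e₁ , e₂ , e₁≢e₂ , here refl , there (here refl)
  two-edges (s≤s ()) | _ ∷ [] | _

  -- Two distinct edges share at most one vertex, which here is `u`. So every neighbour of `v`
  -- misses at least one of two given edges at `u`.
  misses : ∀ {x e₁ e₂} → x ≢ u → e₁ ≢ e₂ → e₁ ∈ H-at u → e₂ ∈ H-at u → ¬ Incident G x e₁ ⊎ ¬ Incident G x e₂
  misses {x} {e₁} {e₂} x≢u e₁≢e₂ e₁∈ e₂∈ with incident? G x e₁ | incident? G x e₂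
  ... | no x∉e₁ | _       = inj₁ x∉e₁
  ... | yes _   | no x∉e₂ = inj₂ x∉e₂
  ... | yes x∈e₁ | yes x∈e₂ = contradiction
    (endpoints-determine x≢u x∈e₁ (proj₂ (∈-H-at⁻ e₁∈)) x∈e₂ (proj₂ (∈-H-at⁻ e₂∈))) e₁≢e₂

  -- All labels at `v` exceed k, whereas `partial u` is at most k because `u` lies on at most one
  -- edge of `H`. No sum away from `v` exceeds `L + ∣E∣ G`, and `bound` puts the sum at `v` above
  -- that.
  few : k < length near → 2 ≤ length near → deg u ≤ 1 → Antimagic G
  few k<N 2≤N d≤1 = antimagic
      (λ x∈ eq → <⇒≢ (≤-<-trans partial-u≤k (≤-trans (s≤s (m≤m+n k _)) (m≤n+m _ (partial _)))) (sym eq))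
      (λ {x} x∈ → <⇒≢ (begin-strict
        partial x + σ (rank x) + L    ≤⟨ +-monoˡ-≤ L (+-mono-≤ (partial≤L x) (σ≤m (rank-< x∈))) ⟩
        L + ∣E∣ G + L                 <⟨ bound ⟩
        ∑ suc (upTo (∣E∣ G))          ∎))
      (<⇒≢ (begin-strict
        partial u + L                 ≤⟨ +-monoˡ-≤ L (≤-trans (partial≤L u) (m≤m+n L (∣E∣ G))) ⟩
        L + ∣E∣ G + L                 <⟨ bound ⟩
        ∑ suc (upTo (∣E∣ G))          ∎))
    where
    open ≤-Reasoning
    σ : ℕ → ℕ
    σ q = suc (k + q)

    L : ℕ
    L = ∑ suc (upTo k)

    σ≤m : ∀ {q} → q < length near → σ q ≤ ∣E∣ G
    σ≤m {q} q<N = begin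
      suc (k + q)      ≡⟨ cong suc (+-comm k q) ⟩
      suc q + k        ≤⟨ +-monoˡ-≤ k q<N ⟩
      length near + k  ≡⟨ ∣E∣≡ ⟨
      ∣E∣ G            ∎

    open Labels index index-injective σ suc (s≤s ∘ +-monoʳ-< k) s≤s (λ _ → z<s) (λ _ → z<s)
      (λ {p} {q} _ q<k eq → <⇒≢ (<-≤-trans q<k (m≤m+n k p)) (sym (suc-injective eq)))
      σ≤m (λ q<k → ≤-trans q<k (subst (k ≤_) (sym ∣E∣≡) (m≤n+m k _)))

    partial-u≤k : partial u ≤ k
    partial-u≤k = ≤-trans
      (∑-upper h k (H-at u) λ e∈ → rankᴴ-< (proj₁ (∈-H-at⁻ {u} e∈)))
      (≤-trans (*-monoʳ-≤ k d≤1) (≤-reflexive (*-identityʳ k)))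

    partial≤L : ∀ x → partial x ≤ L
    partial≤L x = subst (partial x ≤_) (partial+off x) (m≤m+n _ _)

    arithmetic : ∀ k N → k < N → 2 ≤ N → 2 * (k * suc k) + 2 * (N + k) < (N + k) * suc (N + k)
    arithmetic k N k<N 2≤N with m≤n⇒∃[o]m+o≡n k<N
    -- For k = 0 the difference is N(N - 1), which is positive because 2 ≤ N.
    arithmetic zero    N k<N (s≤s ()) | zero , refl
    arithmetic zero    N k<N 2≤N | suc j , refl = subst (2 * 0 + 2 * (suc 0 + suc j + 0) <_) (lemma j) (m<m+n _ z<s)
      where
      lemma : ∀ j → 2 * 0 + 2 * (suc 0 + suc j + 0) + (suc j + suc j * suc j) ≡ (suc 0 + suc j + 0) * suc (suc 0 + suc j + 0)
      lemma = solve-∀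
    -- With N = k + 1 + j, where k ≥ 1 is the original value, the difference is 2k² + j(4k + 1) +
    -- j². Later strict inequalities are likewise proved by a ring identity that exhibits the
    -- difference.
    arithmetic (suc k) N k<N 2≤N | j , refl =
      subst (2 * (suc k * suc (suc k)) + 2 * (suc (suc k) + j + suc k) <_) (lemma k j) (m<m+n _ z<s)
      where
      lemma : ∀ k j → 2 * (suc k * suc (suc k)) + 2 * (suc (suc k) + j + suc k) + (2 * (suc k * suc k) + j * (4 * suc k + 1) + j * j)
                    ≡ (suc (suc k) + j + suc k) * suc (suc (suc k) + j + suc k)
      lemma = solve-∀

    bound : L + ∣E∣ G + L < ∑ suc (upTo (∣E∣ G))
    bound = *-cancelˡ-< 2 _ _ (begin-strict
      2 * (L + ∣E∣ G + L)                           ≡⟨ regroup L (∣E∣ G) ⟩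
      2 * (2 * L) + 2 * ∣E∣ G                       ≡⟨ cong₂ (λ x y → 2 * x + 2 * y) (2*∑-suc k) ∣E∣≡ ⟩
      2 * (k * suc k) + 2 * (length near + k)       <⟨ arithmetic k (length near) k<N 2≤N ⟩
      (length near + k) * suc (length near + k)     ≡⟨ cong (λ m → m * suc m) ∣E∣≡ ⟨
      ∣E∣ G * suc (∣E∣ G)                           ≡⟨ 2*∑-suc (∣E∣ G) ⟨
      2 * ∑ suc (upTo (∣E∣ G))                      ∎)
      where
      regroup : ∀ L m → 2 * (L + m + L) ≡ 2 * (2 * L) + 2 * m
      regroup = solve-∀

  -- Both edges of `H` end at `u`. With N neighbours of `v` and m = N + 2, the sum at `u` is N + 4.
  -- A neighbour of `v` on the edge labelled N + 2 could only match it with the label 2 at `v`,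
  -- which is taken by `H`; the others reach at most N + 3.
  two : k < length near → k ≡ 2 → 2 ≤ deg u → Antimagic G
  two k<N k≡2 2≤d with two-edges 2≤d
  ... | e₁ , e₂ , e₁≢e₂ , e₁∈ , e₂∈ = antimagic near≢u near≢v
      (<⇒≢ (≤-<-trans (≤-reflexive (cong₂ _+_ (trans partial-u L≡) L≡)) (half-bound (4 + N + (4 + N)) (u-bound 3≤N))))
    where
    open ≤-Reasoning
    N : ℕ
    N = length near

    3≤N : 3 ≤ N
    3≤N = subst (_< N) k≡2 k<N

    m≡ : ∣E∣ G ≡ 2 + N
    m≡ = trans ∣E∣≡ (trans (cong (N +_) k≡2) (+-comm N 2))

    -- `σ` enumerates 1, 3, ..., N + 1, and `τ` takes the values 2 and N + 2 on its first two
    -- indices; beyond these only monotonicity matters.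
    σ τ : ℕ → ℕ
    σ zero    = 1
    σ (suc q) = 3 + q
    τ q = 2 + q * N

    σ-mono : ∀ {p q} → p < q → σ p < σ q
    σ-mono {zero}  {suc q} _         = s≤s (s≤s z≤n)
    σ-mono {suc p} {suc q} (s≤s p<q) = +-monoʳ-< 3 p<q

    0<σ : ∀ q → 0 < σ q
    0<σ zero    = z<s
    0<σ (suc q) = z<s

    σ≤ : ∀ {q} → q < N → σ q ≤ suc N
    σ≤ {zero}  _   = s≤s z≤n
    σ≤ {suc q} q<N = s≤s q<N

    τ-cases : ∀ {q} → q < k → τ q ≡ 2 ⊎ τ q ≡ 2 + N
    τ-cases {zero}        _   = inj₁ refl
    τ-cases {suc zero}    _   = inj₂ (cong (2 +_) (+-identityʳ N))
    τ-cases {suc (suc q)} q<k = contradiction (subst (suc (suc q) <_) k≡2 q<k) (≤⇒≯ (s≤s (s≤s z≤n)))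

    σ≢2 : ∀ q → σ q ≢ 2
    σ≢2 zero    ()
    σ≢2 (suc q) ()

    σ≢τ : ∀ {p q} → p < N → q < k → σ p ≢ τ q
    σ≢τ {p} {q} p<N q<k eq with τ-cases q<k
    ... | inj₁ τ≡ = σ≢2 p (trans eq τ≡)
    ... | inj₂ τ≡ = <⇒≢ (s≤s (σ≤ p<N)) (trans eq τ≡)

    τ≤m : ∀ {q} → q < k → τ q ≤ ∣E∣ G
    τ≤m q<k with τ-cases q<k
    ... | inj₁ τ≡ = subst (_≤ ∣E∣ G) (sym τ≡) (subst (2 ≤_) (sym m≡) (s≤s (s≤s z≤n)))
    ... | inj₂ τ≡ = ≤-reflexive (trans τ≡ (sym m≡))

    open Labels index index-injective σ τ σ-mono
      (λ p<q → +-monoʳ-< 2 (*-monoˡ-< N ⦃ >-nonZero (≤-trans z<s 3≤N) ⦄ p<q)) 0<σ (λ _ → z<s) σ≢τ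
      (λ q<N → ≤-trans (σ≤ q<N) (subst (suc N ≤_) (sym m≡) (n≤1+n _))) τ≤m

    L≡ : ∑ τ (upTo k) ≡ 4 + N
    L≡ = trans (cong (λ z → ∑ τ (upTo z)) k≡2) (lemma N)
      where
      lemma : ∀ N → 2 + 0 * N + (2 + 1 * N + 0) ≡ 4 + N
      lemma = solve-∀

    off-u : length (H-off u) ≡ 0
    off-u = n≤0⇒n≡0 (+-cancelˡ-≤ 2 _ _ (begin
      2 + length (H-off u)       ≤⟨ +-monoˡ-≤ _ 2≤d ⟩
      deg u + length (H-off u)   ≡⟨ deg+off u ⟩
      k                          ≡⟨ k≡2 ⟩
      2                          ∎))

    H⇒u : ∀ {e} → e ∈ H → Incident G u e
    H⇒u {e} e∈ with incident? G u e
    ... | yes u∈e = u∈e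
    ... | no u∉e with H-off u | ∈-H-off⁺ e∈ u∉e | off-u
    ...   | _ ∷ _ | _ | ()

    partial-u : partial u ≡ ∑ τ (upTo k)
    partial-u with H-off u | off-u | partial+off u
    ... | [] | _ | eq = trans (sym (+-identityʳ _)) eq

    deg≤1 : ∀ {x} → x ∈ near → deg x ≤ 1
    deg≤1 {x} x∈ with misses (near⇒≢u x∈) e₁≢e₂ e₁∈ e₂∈
    ... | inj₁ x∉e₁ = s≤s⁻¹ (subst (deg x <_) k≡2 (deg<k (proj₁ (∈-H-at⁻ {u} e₁∈)) x∉e₁))
    ... | inj₂ x∉e₂ = s≤s⁻¹ (subst (deg x <_) k≡2 (deg<k (proj₁ (∈-H-at⁻ {u} e₂∈)) x∉e₂))

    partial-cases : ∀ {x} → x ∈ near →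
      partial x ≤ 2 ⊎ (partial x ≡ 2 + N × ∃[ e ] (e ∈ H × Incident G x e × h e ≡ 2 + N))
    partial-cases {x} x∈ with H-at x | deg≤1 x∈ | (λ {e} → ∈-H-at⁻ {x} {e})
    ... | []     | _ | _ = inj₁ z≤n
    ... | e ∷ [] | _ | sound with sound (here refl)
    ...   | e∈ , x∈e with τ-cases (rankᴴ-< e∈)
    ...     | inj₁ he≡ = inj₁ (≤-reflexive (trans (+-identityʳ _) he≡))
    ...     | inj₂ he≡ = inj₂ (trans (+-identityʳ _) he≡ , e , e∈ , x∈e , he≡)
    partial-cases {x} x∈ | _ ∷ _ ∷ _ | s≤s () | _

    -- Only one edge has the label N + 2, and one of its two ends is `u` by `H⇒u`, so a single
    -- candidate remains.
    large-unique : ∀ {x y} → x ∈ near → y ∈ near → partial x ≡ 2 + N → partial x ≤ partial y → y ≡ x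
    large-unique {x} {y} x∈ y∈ px≡ px≤py with partial-cases x∈ | partial-cases y∈
    ... | inj₁ px≤2 | _ = contradiction (subst (_≤ 2) px≡ px≤2) (<⇒≱ (+-monoʳ-< 2 (≤-trans z<s 3≤N)))
    ... | inj₂ _ | inj₁ py≤2 = contradiction (≤-trans (subst (_≤ partial y) px≡ px≤py) py≤2) (<⇒≱ (+-monoʳ-< 2 (≤-trans z<s 3≤N)))
    ... | inj₂ (_ , e , e∈ , x∈e , he≡) | inj₂ (_ , e′ , e′∈ , y∈e′ , he′≡) with y Finₚ.≟ x
    ...   | yes y≡x = y≡x
    ...   | no y≢x with rankᴴ-injective e∈ e′∈ (*-cancelʳ-≡ _ _ N ⦃ >-nonZero (≤-trans z<s 3≤N) ⦄ (+-cancelˡ-≡ 2 _ _ (trans he≡ (sym he′≡))))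
    ...     | refl = contradiction (third y∈e′ x∈e (H⇒u e∈)) λ ()
      where
      third : Incident G y e → Incident G x e → Incident G u e → ⊥
      third (inj₁ p) (inj₁ q) _        = y≢x (trans p (sym q))
      third (inj₁ p) _        (inj₁ q) = near⇒≢u y∈ (trans p (sym q))
      third (inj₂ p) (inj₂ q) _        = y≢x (trans p (sym q))
      third (inj₂ p) _        (inj₂ q) = near⇒≢u y∈ (trans p (sym q))
      third _        (inj₁ p) (inj₁ q) = near⇒≢u x∈ (trans p (sym q))
      third _        (inj₂ p) (inj₂ q) = near⇒≢u x∈ (trans p (sym q))

    -- No other neighbour has so large a partial sum, so `x` comes last. The exact label is wanted
    -- because an upper bound on the sum at `x` would not separate it from the sum at `v` when N =
    -- 3.
    large-rank : ∀ {x} → x ∈ near → partial x ≡ 2 + N → σ (rank x) ≡ suc N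
    large-rank {x} x∈ px≡ = ≤-antisym (σ≤ (rank-< x∈)) (lower (rank x) (subst (N ≤_) (+-comm (rank x) 1)
      (near≤rank+above x (x ∷ []) λ y∈ px≤py → here (large-unique x∈ y∈ px≡ px≤py))))
      where
      lower : ∀ q → N ≤ suc q → suc N ≤ σ q
      lower zero    N≤1 = contradiction (≤-trans 3≤N N≤1) λ where (s≤s ())
      lower (suc q) N≤q = s≤s N≤q

    near≢u : ∀ {x} → x ∈ near → total x ≢ partial u
    near≢u {x} x∈ eq with partial-cases x∈
    ... | inj₁ px≤2 = <⇒≢ (s≤s (+-mono-≤ px≤2 (σ≤ (rank-< x∈)))) (trans eq (trans partial-u L≡))
    ... | inj₂ (px≡ , _) = σ≢2 (rank x) (+-cancelˡ-≡ (2 + N) _ _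
      (trans (cong (_+ σ (rank x)) (sym px≡)) (trans eq (trans partial-u (trans L≡ (+-comm 2 (2 + N)))))))

    2T≡ : 2 * ∑ suc (upTo (∣E∣ G)) ≡ (2 + N) * (3 + N)
    2T≡ = trans (2*∑-suc (∣E∣ G)) (cong (λ m → m * suc m) m≡)

    half-bound : ∀ y → 2 * y < (2 + N) * (3 + N) → y < ∑ suc (upTo (∣E∣ G))
    half-bound y lt = *-cancelˡ-< 2 _ _ (subst (2 * y <_) (sym 2T≡) lt)

    u-bound : ∀ {N} → 3 ≤ N → 2 * (4 + N + (4 + N)) < (2 + N) * (3 + N)
    u-bound 3≤N with m≤n⇒∃[o]m+o≡n 3≤N
    ... | j , refl = subst (2 * (4 + (3 + j) + (4 + (3 + j))) <_) (lemma j) (m<m+n _ z<s)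
      where
      lemma : ∀ j → 2 * (4 + (3 + j) + (4 + (3 + j))) + (2 + (j * j + 7 * j)) ≡ (2 + (3 + j)) * (3 + (3 + j))
      lemma = solve-∀

    near≢v : ∀ {x} → x ∈ near → total x + ∑ τ (upTo k) ≢ ∑ suc (upTo (∣E∣ G))
    near≢v {x} x∈ with partial-cases x∈
    ... | inj₁ px≤2 = <⇒≢ (≤-<-trans
      (+-mono-≤ (≤-trans (+-mono-≤ px≤2 (σ≤ (rank-< x∈))) (n≤1+n (3 + N))) (≤-reflexive L≡))
      (half-bound (4 + N + (4 + N)) (u-bound 3≤N)))
    ... | inj₂ (px≡ , _) = λ eq → impossible 3≤N (trans
      (cong (2 *_) (trans (sym (cong₂ _+_ (cong₂ _+_ px≡ (large-rank x∈ px≡)) L≡)) eq)) 2T≡)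
      where
      impossible : ∀ {N} → 3 ≤ N → 2 * (2 + N + suc N + (4 + N)) ≢ (2 + N) * (3 + N)
      impossible 3≤N eq with m≤n⇒∃[o]m+o≡n 3≤N
      -- For N = 3 the sum at `v` is the smaller one, 8 against 9; from N = 4 on it is the larger
      -- one.
      ... | zero  , refl = contradiction eq λ ()
      ... | suc j , refl = <⇒≢ (m<m+n _ z<s) (trans eq (sym (lemma j)))
        where
        lemma : ∀ j → 2 * (2 + (3 + suc j) + suc (3 + suc j) + (4 + (3 + suc j))) + (4 + (j * j + 7 * j)) ≡ (2 + (3 + suc j)) * (3 + (3 + suc j))
        lemma = solve-∀

  -- Three or more edges avoiding the centre, at least two of them at its non-neighbour

  heavy : List (Fin n)
  heavy = filter (λ x → 2 ≤? deg x) near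

  ∈-heavy⁻ : ∀ {x} → x ∈ heavy → x ∈ near × 2 ≤ deg x
  ∈-heavy⁻ = ∈-filter⁻ (λ x → 2 ≤? deg x) {xs = near}

  -- The handshake inequality for `u`, `x` and the heavy vertices other than `x`, each of which
  -- contributes at least 2. Taking out `x` removes at most one heavy vertex, whence the summand 2
  -- on the right.
  heavy-bound : ∀ {x} → x ∈ near → deg u + deg x + 2 * length heavy ≤ 2 * k + 2
  heavy-bound {x} x∈ = begin
    deg u + deg x + 2 * length heavy              ≤⟨ +-monoʳ-≤ (deg u + deg x) (*-monoʳ-≤ 2 heavy≤) ⟩
    deg u + deg x + 2 * suc (length rest)         ≡⟨ regroup (deg u) (deg x) (length rest) ⟩
    deg u + (deg x + 2 * length rest) + 2         ≤⟨ +-monoˡ-≤ 2 (+-monoʳ-≤ (deg u) (+-monoʳ-≤ (deg x)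
                                                       (∑-lower deg 2 rest (proj₂ ∘ ∈-heavy⁻ ∘ proj₁ ∘ ∈-rest⁻)))) ⟩
    ∑ deg (u ∷ x ∷ rest) + 2                      ≤⟨ +-monoˡ-≤ 2 (handshake distinct) ⟩
    2 * k + 2                                     ∎
    where
    open ≤-Reasoning
    rest : List (Fin n)
    rest = filter (λ y → ¬? (y Finₚ.≟ x)) heavy

    ∈-rest⁻ : ∀ {y} → y ∈ rest → y ∈ heavy × y ≢ x
    ∈-rest⁻ = ∈-filter⁻ (λ y → ¬? (y Finₚ.≟ x)) {xs = heavy}

    heavy-unique : Unique heavy
    heavy-unique = Unique.filter⁺ (λ x → 2 ≤? deg x) near-unique

    distinct : Unique (u ∷ x ∷ rest)
    distinct = All.tabulate (λ where
        (here refl) eq → near⇒≢u x∈ (sym eq)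
        (there y∈)  eq → near⇒≢u (proj₁ (∈-heavy⁻ (proj₁ (∈-rest⁻ y∈)))) (sym eq))
      ∷ All.tabulate (λ y∈ x≡y → proj₂ (∈-rest⁻ y∈) (sym x≡y))
      ∷ Unique.filter⁺ (λ y → ¬? (y Finₚ.≟ x)) heavy-unique

    heavy≤ : length heavy ≤ suc (length rest)
    heavy≤ = length-⊆ {ys = x ∷ rest} heavy-unique λ {y} y∈ → case y Finₚ.≟ x of λ where
      (yes y≡x) → here y≡x
      (no y≢x)  → there (∈-filter⁺ (λ y → ¬? (y Finₚ.≟ x)) y∈ y≢x)

    regroup : ∀ d t l → d + t + 2 * suc l ≡ d + (t + 2 * l) + 2
    regroup = solve-∀

  module TopKey (e₁ e₂ : Edge G) (e₁≢e₂ : e₁ ≢ e₂) where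

    private
      index< : ∀ e → index e < n * n
      index< e = Finₚ.toℕ<n (combine (Edge.i e) (Edge.j e))

    -- All indices are below `n * n`, so these values move `e₁` and `e₂` to the end of the order,
    -- where they receive the two largest labels of `H`.
    key : Edge G → ℕ
    key e with index e ≟ index e₁ | index e ≟ index e₂
    ... | yes _ | _     = suc (n * n)
    ... | no  _ | yes _ = n * n
    ... | no  _ | no  _ = index e

    key-injective : ∀ {e e′} → key e ≡ key e′ → e ≡ e′
    key-injective {e} {e′} eq
      with index e ≟ index e₁ | index e ≟ index e₂ | index e′ ≟ index e₁ | index e′ ≟ index e₂
    ... | yes p | _     | yes q | _     = index-injective (trans p (sym q))
    ... | yes _ | _     | no _  | yes _ = contradiction eq 1+n≢n
    ... | yes _ | _     | no _  | no _  = contradiction (sym eq) (<⇒≢ (m<n⇒m<1+n (index< e′)))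
    ... | no _  | yes _ | yes _ | _     = contradiction (sym eq) 1+n≢n
    ... | no _  | yes p | no _  | yes q = index-injective (trans p (sym q))
    ... | no _  | yes _ | no _  | no _  = contradiction (sym eq) (<⇒≢ (index< e′))
    ... | no _  | no _  | yes _ | _     = contradiction eq (<⇒≢ (m<n⇒m<1+n (index< e)))
    ... | no _  | no _  | no _  | yes _ = contradiction eq (<⇒≢ (index< e))
    ... | no _  | no _  | no _  | no _  = index-injective eq

    key₁ : key e₁ ≡ suc (n * n)
    key₁ with index e₁ ≟ index e₁
    ... | yes _ = refl
    ... | no ¬p = contradiction refl ¬p

    key₂ : key e₂ ≡ n * n
    key₂ with index e₂ ≟ index e₁ | index e₂ ≟ index e₂
    ... | yes p | _     = contradiction (sym (index-injective p)) e₁≢e₂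
    ... | no _  | yes _ = refl
    ... | no _  | no ¬p = contradiction refl ¬p

    above₁ : ∀ {e} → key e₁ ≤ key e → e ∈ e₁ ∷ []
    above₁ {e} le rewrite key₁ with index e ≟ index e₁ | index e ≟ index e₂
    ... | yes p | _     = here (index-injective p)
    ... | no _  | yes _ = contradiction le 1+n≰n
    ... | no _  | no _  = contradiction le (<⇒≱ (m<n⇒m<1+n (index< e)))

    above₂ : ∀ {e} → key e₂ ≤ key e → e ∈ e₁ ∷ e₂ ∷ []
    above₂ {e} le rewrite key₂ with index e ≟ index e₁ | index e ≟ index e₂
    ... | yes p | _     = here (index-injective p)
    ... | no _  | yes p = there (here (index-injective p))
    ... | no _  | no _  = contradiction le (<⇒≱ (index< e))

  -- Here o is the label total of the edges of `H` missing a vertex with partial sum p. From p = L -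
  -- o and o ≥ y - d the sum p + s + L is at most 2L + B - (y - d); the statement avoids the
  -- subtractions.
  cancel-off : ∀ p s o L B d T y → p + o ≡ L → s ≤ B → y ≤ o + d → 2 * L + B + d < T + y → p + s + L < T
  cancel-off p s o L B d T y refl s≤B y≤ lt = +-cancelʳ-< (o + d) (p + s + L) T (begin-strict
    p + s + (p + o) + (o + d)   ≡⟨ regroup p s o d ⟩
    2 * (p + o) + s + d         ≤⟨ +-monoˡ-≤ d (+-monoʳ-≤ (2 * (p + o)) s≤B) ⟩
    2 * (p + o) + B + d         <⟨ lt ⟩
    T + y                       ≤⟨ +-monoʳ-≤ T y≤ ⟩
    T + (o + d)                 ∎)
    where
    open ≤-Reasoning
    regroup : ∀ p s o d → p + s + (p + o) + (o + d) ≡ 2 * (p + o) + s + d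
    regroup = solve-∀

  -- The high block of `τ` has 2 + c labels: enough for `e₁` and `e₂`, and at least as many as there
  -- are heavy vertices. The low block has the other a labels, and all 2r labels between the blocks
  -- go to edges at `v`.
  module Many (e₁ e₂ : Edge G) (e₁≢e₂ : e₁ ≢ e₂) (e₁∈ : e₁ ∈ H-at u) (e₂∈ : e₂ ∈ H-at u)
              (a c r : ℕ) (k≡ : k ≡ a + (2 + c)) (heavy≤ : length heavy ≤ 2 + c)
              (2r+k≤N : 2 * r + k ≤ length near)
              (σ≤m : ∀ {q} → q < length near → Sequences.σ a r q ≤ ∣E∣ G) where

    open Sequences a r
    open TopKey e₁ e₂ e₁≢e₂
    open ≤-Reasoning

    a+2≤k : a + 2 ≤ k
    a+2≤k = subst (a + 2 ≤_) (sym k≡) (+-monoʳ-≤ a (m≤m+n 2 c))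

    τ≤top : ∀ {q} → q < k → τ q ≤ 2 * (k + r)
    τ≤top {q} q<k = ≤-trans (τ≤ {q}) (*-monoʳ-≤ 2 (+-monoˡ-≤ r q<k))

    top≤m : 2 * (k + r) ≤ ∣E∣ G
    top≤m = begin
      2 * (k + r)       ≡⟨ regroup k r ⟩
      2 * r + k + k     ≤⟨ +-monoˡ-≤ k 2r+k≤N ⟩
      length near + k   ≡⟨ ∣E∣≡ ⟨
      ∣E∣ G             ∎
      where
      regroup : ∀ k r → 2 * (k + r) ≡ 2 * r + k + k
      regroup = solve-∀

    open Labels key key-injective σ τ σ-mono τ-mono 0<σ (λ q → ≤-trans z<s (2≤τ q)) (λ {p} {q} _ _ → σ≢τ p q)
      σ≤m (λ {q} q<k → ≤-trans (τ≤top {q} q<k) top≤m) public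

    L : ℕ
    L = ∑ τ (upTo k)

    h₁≥ : 2 * (k + r) ≤ h e₁
    h₁≥ = begin
      2 * (k + r)                 ≤⟨ *-monoʳ-≤ 2 (+-monoˡ-≤ r k≤) ⟩
      2 * (suc (rankᴴ e₁) + r)    ≡⟨ τ-high (s≤s⁻¹ (≤-trans (subst (_≤ a + 2) (+-comm a 1) (+-monoʳ-≤ a (s≤s z≤n))) (≤-trans a+2≤k k≤))) ⟨
      h e₁                        ∎
      where
      k≤ : k ≤ suc (rankᴴ e₁)
      k≤ = subst (k ≤_) (+-comm (rankᴴ e₁) 1) (k≤rankᴴ+above e₁ (e₁ ∷ []) λ _ → above₁)

    -- Only `e₁` has a larger key, so the rank is at least k - 2. This is at least a, and the label
    -- lies in the high block.
    h₂≥ : 2 * (k + r) ≤ h e₂ + 2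
    h₂≥ = begin
      2 * (k + r)                      ≤⟨ *-monoʳ-≤ 2 (+-monoˡ-≤ r k≤) ⟩
      2 * (rankᴴ e₂ + 2 + r)           ≡⟨ regroup (rankᴴ e₂) r ⟩
      2 * (suc (rankᴴ e₂) + r) + 2     ≡⟨ cong (_+ 2) (τ-high (+-cancelʳ-≤ 2 _ _ (≤-trans a+2≤k k≤))) ⟨
      h e₂ + 2                         ∎
      where
      k≤ : k ≤ rankᴴ e₂ + 2
      k≤ = k≤rankᴴ+above e₂ (e₁ ∷ e₂ ∷ []) λ _ → above₂
      regroup : ∀ x r → 2 * (x + 2 + r) ≡ 2 * (suc x + r) + 2
      regroup = solve-∀

    off-edge : ∀ {x} → x ∈ near → ∃[ e ] (e ∈ H × ¬ Incident G x e × 2 * (k + r) ≤ h e + 2)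
    off-edge x∈ with misses (near⇒≢u x∈) e₁≢e₂ e₁∈ e₂∈
    ... | inj₁ x∉e₁ = e₁ , proj₁ (∈-H-at⁻ {u} e₁∈) , x∉e₁ , ≤-trans h₁≥ (m≤m+n _ 2)
    ... | inj₂ x∉e₂ = e₂ , proj₁ (∈-H-at⁻ {u} e₂∈) , x∉e₂ , h₂≥

    deg-near<k : ∀ {x} → x ∈ near → deg x < k
    deg-near<k x∈ with off-edge x∈
    ... | e , e∈ , x∉e , _ = deg<k e∈ x∉e

    -- Of the k - deg x labels missing `x`, one is at least 2(k + r) - 2 by `off-edge`, and each of
    -- the others is at least 2.
    off-near : ∀ {x} → x ∈ near → 2 * r + 4 * k ≤ ∑ h (H-off x) + (2 * deg x + 4)
    off-near {x} x∈ =
      let e , e∈ , x∉e , he≥ = off-edge x∈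
          es , off↭          = ∈⇒↭ (∈-H-off⁺ e∈ x∉e)
      in remove e es off↭ he≥
      where
      regroup₁ : ∀ r k → 2 * r + 4 * k ≡ 2 * (k + r) + 2 * k
      regroup₁ = solve-∀
      regroup₂ : ∀ h d l → h + 2 + 2 * (d + suc l) ≡ h + 2 * l + (2 * d + 4)
      regroup₂ = solve-∀

      arithmetic : ∀ k d l y o → k ≡ d + suc l → 2 * (k + r) ≤ y + 2 → y + 2 * l ≤ o → 2 * r + 4 * k ≤ o + (2 * d + 4)
      arithmetic k d l y o k≡ y≥ ≤o = begin
        2 * r + 4 * k                   ≡⟨ regroup₁ r k ⟩
        2 * (k + r) + 2 * k             ≤⟨ +-mono-≤ y≥ (≤-reflexive (cong (2 *_) k≡)) ⟩
        y + 2 + 2 * (d + suc l)         ≡⟨ regroup₂ y d l ⟩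
        y + 2 * l + (2 * d + 4)         ≤⟨ +-monoˡ-≤ (2 * d + 4) ≤o ⟩
        o + (2 * d + 4)                 ∎

      remove : ∀ e es → H-off x ↭ e ∷ es → 2 * (k + r) ≤ h e + 2 → 2 * r + 4 * k ≤ ∑ h (H-off x) + (2 * deg x + 4)
      remove e es off↭ he≥ = arithmetic k (deg x) (length es) (h e) (∑ h (H-off x))
        (trans (sym (deg+off x)) (cong (deg x +_) (↭-length off↭))) he≥
        (subst (h e + 2 * length es ≤_) (sym (∑-↭ h off↭)) (+-monoʳ-≤ (h e) (∑-lower h 2 es (λ {e} _ → 2≤τ (rankᴴ e)))))

    off-u : 2 * k ≤ ∑ h (H-off u) + 2 * deg u
    off-u = begin
      2 * k                                   ≡⟨ cong (2 *_) (deg+off u) ⟨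
      2 * (deg u + length (H-off u))          ≡⟨ regroup (deg u) (length (H-off u)) ⟩
      2 * length (H-off u) + 2 * deg u        ≤⟨ +-monoˡ-≤ (2 * deg u) (∑-lower h 2 (H-off u) (λ {e} _ → 2≤τ (rankᴴ e))) ⟩
      ∑ h (H-off u) + 2 * deg u               ∎
      where
      regroup : ∀ d l → 2 * (d + l) ≡ 2 * l + 2 * d
      regroup = solve-∀

    partial-even : ∀ x → ∃[ y ] partial x ≡ 2 * y
    partial-even x = even-sum (H-at x)
      where
      even-sum : ∀ es → ∃[ y ] ∑ h es ≡ 2 * y
      even-sum []       = 0 , refl
      even-sum (e ∷ es) with τ-even (rankᴴ e) | even-sum es
      ... | y , he≡ | z , ∑≡ = y + z , trans (cong₂ _+_ he≡ ∑≡) (sym (*-distribˡ-+ 2 y z))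

    partial-light : ∀ {x} → deg x ≤ 1 → partial x ≤ 2 * (k + r)
    partial-light {x} d≤1 = ≤-trans
      (∑-upper h (2 * (k + r)) (H-at x) λ {e} e∈ → τ≤top {rankᴴ e} (rankᴴ-< (proj₁ (∈-H-at⁻ {x} e∈))))
      (≤-trans (*-monoʳ-≤ (2 * (k + r)) d≤1) (≤-reflexive (*-identityʳ _)))

    -- Everything ranked above a vertex whose partial sum exceeds the largest
    -- label of H is heavy, and there are few heavy vertices.
    partial-low-rank : ∀ {x} → rank x < a + 2 * r → partial x ≤ 2 * (k + r)
    partial-low-rank {x} rank< = ≮⇒≥ λ big → <⇒≱ rank< (+-cancelʳ-≤ (2 + c) (a + 2 * r) (rank x) (begin
      a + 2 * r + (2 + c)      ≡⟨ regroup a r c ⟩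
      2 * r + (a + (2 + c))    ≡⟨ cong (2 * r +_) k≡ ⟨
      2 * r + k                ≤⟨ 2r+k≤N ⟩
      length near              ≤⟨ near≤rank+above x heavy (λ {y} y∈ px≤py →
                                    ∈-filter⁺ (λ x → 2 ≤? deg x) y∈ (≰⇒> λ d≤1 →
                                      <⇒≱ big (≤-trans px≤py (partial-light d≤1)))) ⟩
      rank x + length heavy    ≤⟨ +-monoʳ-≤ (rank x) heavy≤ ⟩
      rank x + (2 + c)         ∎))
      where
      regroup : ∀ a r c → a + 2 * r + (2 + c) ≡ 2 * r + (a + (2 + c))
      regroup = solve-∀

    partial-u≥ : 2 * (k + r) + 2 * (k + r) ≤ partial u + 2
    partial-u≥ = begin
      2 * (k + r) + 2 * (k + r)    ≤⟨ +-mono-≤ h₁≥ h₂≥ ⟩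
      h e₁ + (h e₂ + 2)            ≡⟨ regroup (h e₁) (h e₂) ⟩
      ∑ h (e₁ ∷ e₂ ∷ []) + 2       ≤⟨ +-monoˡ-≤ 2 (∑-⊆ h ((e₁≢e₂ ∷ []) ∷ [] ∷ []) λ where
                                        (here refl)         → e₁∈
                                        (there (here refl)) → e₂∈) ⟩
      partial u + 2                ∎
      where
      regroup : ∀ x y → x + (y + 2) ≡ x + (y + 0) + 2
      regroup = solve-∀

    -- The partial sum is at most 2(k + r) and the label at `v` at most 2(a + r), hence at most 2(k
    -- + r) - 4. The two largest labels of `H` give `u` at least 4(k + r) - 2.
    low≢u : ∀ {x} → rank x < a + 2 * r → total x ≢ partial u
    low≢u {x} rank< = <⇒≢ (arithmetic k (partial x) (σ (rank x)) (partial u)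
        (partial-low-rank {x} rank<) (σ-low {rank x} rank<) a+2≤k partial-u≥)
      where
      regroup : ∀ k a r → 2 * (k + r) + 2 * (a + r) + 2 + 2 ≡ 2 * (k + r) + 2 * (a + 2 + r)
      regroup = solve-∀
      arithmetic : ∀ k p s w → p ≤ 2 * (k + r) → s ≤ 2 * (a + r) → a + 2 ≤ k → 2 * (k + r) + 2 * (k + r) ≤ w + 2 → p + s < w
      arithmetic k p s w p≤ s≤ a+2≤k ≤w = +-cancelʳ-< 2 (p + s) w (begin-strict
        p + s + 2                              ≤⟨ +-monoˡ-≤ 2 (+-mono-≤ p≤ s≤) ⟩
        2 * (k + r) + 2 * (a + r) + 2          <⟨ m<m+n _ z<s ⟩
        2 * (k + r) + 2 * (a + r) + 2 + 2      ≡⟨ regroup k a r ⟩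
        2 * (k + r) + 2 * (a + 2 + r)          ≤⟨ +-monoʳ-≤ (2 * (k + r)) (*-monoʳ-≤ 2 (+-monoˡ-≤ r a+2≤k)) ⟩
        2 * (k + r) + 2 * (k + r)              ≤⟨ ≤w ⟩
        w + 2                                  ∎)

    -- Parity: the label at `v` is odd, while all labels of `H` are even.
    high≢u : ∀ {x} → a + 2 * r ≤ rank x → total x ≢ partial u
    high≢u {x} ≤rank = parity (rank x ∸ r) (partial-even x) (σ-high {rank x} ≤rank) (partial-even u)
      where
      regroup : ∀ y w → 2 * y + suc (2 * w) ≡ suc (2 * (y + w))
      regroup = solve-∀
      parity : ∀ {p s t} w → ∃[ y ] p ≡ 2 * y → s ≡ suc (2 * w) → ∃[ z ] t ≡ 2 * z → p + s ≢ t
      parity w (y , refl) refl (z , refl) eq = even≢odd z (y + w) (trans (sym eq) (regroup y w))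

    near≢u : ∀ {x} → x ∈ near → total x ≢ partial u
    near≢u {x} _ = case <-≤-connex (rank x) (a + 2 * r) of λ where
      (inj₁ rank<) → low≢u {x} rank<
      (inj₂ ≤rank) → high≢u {x} ≤rank

    near<v : ∀ {x B T} → x ∈ near → σ (rank x) ≤ B →
             2 * L + B + (2 * deg x + 4) < T + (2 * r + 4 * k) → total x + L < T
    near<v {x} {B} {T} x∈ σ≤B lt =
      cancel-off (partial x) (σ (rank x)) (∑ h (H-off x)) L B (2 * deg x + 4) T (2 * r + 4 * k) (partial+off x) σ≤B (off-near x∈) lt

    u<v : ∀ {T} → 2 * L + 2 * deg u < T + 2 * k → partial u + L < T
    -- No edge joins `u` to `v`, so 0 replaces the label at `v` in `cancel-off`.
    u<v {T} lt = subst (λ z → z + L < T) (+-identityʳ (partial u))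
      (cancel-off (partial u) 0 (∑ h (H-off u)) L 0 (2 * deg u) T (2 * k) (partial+off u) z≤n off-u
        (subst (λ z → z + 2 * deg u < T + 2 * k) (sym (+-identityʳ (2 * L))) lt))

    L≡ : L ≡ (a + (2 + c)) * suc (a + (2 + c)) + 2 * r * (2 + c)
    L≡ = trans (cong (λ z → ∑ τ (upTo z)) k≡) (∑-τ (2 + c))

  -- With at least two heavy vertices this is `heavy-bound` together with 2 ≤ deg u. With at most
  -- two, k = a + 2 and deg x ≤ a + 1, and 3 ≤ k gives a ≥ 1.
  deg-near≤ : ∀ {a x} → k ≡ a + (2 + (length heavy ∸ 2)) → 3 ≤ k → 2 ≤ deg u → x ∈ near → deg x < k → deg x ≤ 2 * a
  deg-near≤ {a} {x} k≡ 3≤k 2≤d x∈ deg<k = case ≤-total 2 (length heavy) of λ where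
      (inj₁ 2≤D) → many-heavy k (deg u) (deg x) (length heavy) (trans k≡ (cong (a +_) (m+[n∸m]≡n 2≤D))) 2≤d (heavy-bound x∈)
      (inj₂ D≤2) → few-heavy a k (deg x) (trans k≡ (cong (λ c → a + (2 + c)) (m≤n⇒m∸n≡0 D≤2))) 3≤k deg<k
    where
    open ≤-Reasoning
    many-heavy : ∀ k d t D → k ≡ a + D → 2 ≤ d → d + t + 2 * D ≤ 2 * k + 2 → t ≤ 2 * a
    many-heavy k d t D refl 2≤d le = +-cancelʳ-≤ (2 + 2 * D) t (2 * a) (begin
      t + (2 + 2 * D)     ≡⟨ regroup₁ t D ⟩
      2 + t + 2 * D       ≤⟨ +-monoˡ-≤ (2 * D) (+-monoˡ-≤ t 2≤d) ⟩
      d + t + 2 * D       ≤⟨ le ⟩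
      2 * (a + D) + 2     ≡⟨ regroup₂ a D ⟩
      2 * a + (2 + 2 * D) ∎)
      where
      regroup₁ : ∀ t D → t + (2 + 2 * D) ≡ 2 + t + 2 * D
      regroup₁ = solve-∀
      regroup₂ : ∀ a D → 2 * (a + D) + 2 ≡ 2 * a + (2 + 2 * D)
      regroup₂ = solve-∀

    few-heavy : ∀ a k t → k ≡ a + 2 → 3 ≤ k → t < k → t ≤ 2 * a
    few-heavy zero    k t refl (s≤s (s≤s ())) _
    few-heavy (suc a) k t refl _ t< = begin
      t                  ≤⟨ s≤s⁻¹ t< ⟩
      a + 2              ≤⟨ m≤m+n (a + 2) a ⟩
      a + 2 + a          ≡⟨ regroup a ⟩
      2 * suc a          ∎
      where
      regroup : ∀ a → a + 2 + a ≡ 2 * suc a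
      regroup = solve-∀

  -- With at least two heavy vertices, `heavy-bound` suffices after dropping deg x; with at most
  -- two, k = a + 2 is itself small enough.
  deg-u≤ : ∀ {a x} → k ≡ a + (2 + (length heavy ∸ 2)) → x ∈ near → deg u ≤ 2 * a + 2
  deg-u≤ {a} {x} k≡ x∈ = case ≤-total 2 (length heavy) of λ where
      (inj₁ 2≤D) → many-heavy k (deg u) (deg x) (length heavy) (trans k≡ (cong (a +_) (m+[n∸m]≡n 2≤D))) (heavy-bound x∈)
      (inj₂ D≤2) → ≤-trans (deg≤k u) (≤-trans (≤-reflexive (trans k≡ (cong (λ c → a + (2 + c)) (m≤n⇒m∸n≡0 D≤2)))) (+-monoˡ-≤ 2 (m≤m+n a _)))
    where
    open ≤-Reasoning
    many-heavy : ∀ k d t D → k ≡ a + D → d + t + 2 * D ≤ 2 * k + 2 → d ≤ 2 * a + 2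
    many-heavy k d t D refl le = +-cancelʳ-≤ (2 * D) d (2 * a + 2) (begin
      d + 2 * D           ≤⟨ +-monoˡ-≤ (2 * D) (m≤m+n d t) ⟩
      d + t + 2 * D       ≤⟨ le ⟩
      2 * (a + D) + 2     ≡⟨ regroup a D ⟩
      2 * a + 2 + 2 * D   ∎)
      where
      regroup : ∀ a D → 2 * (a + D) + 2 ≡ 2 * a + 2 + 2 * D
      regroup = solve-∀

  -- The high block gets size max(2, D), where D is the number of heavy vertices. It fits into k
  -- labels because `heavy-bound` and 2 ≤ deg u give D ≤ k.
  split-k : ∀ {x} → x ∈ near → 3 ≤ k → 2 ≤ deg u → ∃[ a ] k ≡ a + (2 + (length heavy ∸ 2))
  split-k {x} x∈ 3≤k 2≤d = k ∸ (2 + (length heavy ∸ 2)) , sym (m∸n+n≡m (case ≤-total 2 (length heavy) of λ where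
      (inj₁ 2≤D) → subst (_≤ k) (sym (m+[n∸m]≡n 2≤D)) (bound k (deg u) (deg x) (length heavy) 2≤d (heavy-bound x∈))
      (inj₂ D≤2) → subst (λ c → 2 + c ≤ k) (sym (m≤n⇒m∸n≡0 D≤2)) (≤-trans (n≤1+n 2) 3≤k)))
    where
    open ≤-Reasoning
    bound : ∀ k d t D → 2 ≤ d → d + t + 2 * D ≤ 2 * k + 2 → D ≤ k
    bound k d t D 2≤d le = *-cancelˡ-≤ 2 (+-cancelˡ-≤ 2 (2 * D) (2 * k) (begin
      2 + 2 * D         ≤⟨ +-monoˡ-≤ (2 * D) (≤-trans 2≤d (m≤m+n d t)) ⟩
      d + t + 2 * D     ≤⟨ le ⟩
      2 * k + 2         ≡⟨ +-comm (2 * k) 2 ⟩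
      2 + 2 * k         ∎))

  module ManyEven (e₁ e₂ : Edge G) (e₁≢e₂ : e₁ ≢ e₂) (e₁∈ : e₁ ∈ H-at u) (e₂∈ : e₂ ∈ H-at u)
                  (a c r′ : ℕ) (k≡ : k ≡ a + (2 + c)) (heavy≤ : length heavy ≤ 2 + c)
                  (N≡ : length near ≡ 2 * suc r′ + k)
                  (near≤2a : ∀ {x} → x ∈ near → deg x < k → deg x ≤ 2 * a) (u≤2a+2 : deg u ≤ 2 * a + 2) where
    open ≤-Reasoning

    -- In this case m = 2(r + k) is even and is a label of `H`; `B` is m - 1, the largest label at
    -- `v`.
    r B : ℕ
    r = suc r′
    B = suc (2 * (r + (a + suc c)))

    open Sequences a r using (σ; σ≤)

    σ≤B : ∀ {q} → q < length near → σ q ≤ B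
    σ≤B {q} q<N = subst (λ z → σ q ≤ suc (2 * z)) top∸r (σ≤ {q} {2 * r + (a + suc c)} (s≤s⁻¹ (≤-trans q<N (≤-reflexive N≡top))) a+2r≤top)
      where
      N≡top : length near ≡ suc (2 * r + (a + suc c))
      N≡top = trans N≡ (trans (cong (2 * r +_) k≡) (regroup r a c))
        where
        regroup : ∀ r a c → 2 * r + (a + (2 + c)) ≡ suc (2 * r + (a + suc c))
        regroup = solve-∀
      top∸r : 2 * r + (a + suc c) ∸ r ≡ r + (a + suc c)
      top∸r = trans (cong (_∸ r) (regroup r (a + suc c))) (m+n∸m≡n r (r + (a + suc c)))
        where
        regroup : ∀ r y → 2 * r + y ≡ r + (r + y)
        regroup = solve-∀
      a+2r≤top : a + 2 * r ≤ 2 * r + (a + suc c)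
      a+2r≤top = ≤-trans (≤-reflexive (+-comm a (2 * r))) (+-monoʳ-≤ (2 * r) (m≤m+n a (suc c)))

    m≡ : ∣E∣ G ≡ 2 * (r + k)
    m≡ = trans ∣E∣≡ (trans (cong (_+ k) N≡) (regroup r k))
      where
      regroup : ∀ r k → 2 * r + k + k ≡ 2 * (r + k)
      regroup = solve-∀

    B≤m : B ≤ ∣E∣ G
    B≤m = subst (B ≤_) (trans (regroup r a c) (trans (cong (λ k → 2 * (r + k)) (sym k≡)) (sym m≡))) (n≤1+n B)
      where
      regroup : ∀ r a c → suc (suc (2 * (r + (a + suc c)))) ≡ 2 * (r + (a + (2 + c)))
      regroup = solve-∀

    open Many e₁ e₂ e₁≢e₂ e₁∈ e₂∈ a c r k≡ heavy≤ (≤-reflexive (sym N≡)) (λ q<N → ≤-trans (σ≤B q<N) B≤m)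

    T≡ : ∑ suc (upTo (∣E∣ G)) ≡ (r + k) * suc (2 * (r + k))
    T≡ = *-cancelˡ-≡ _ _ 2 (trans (2*∑-suc (∣E∣ G)) (trans (cong (λ m → m * suc m) m≡) (*-assoc 2 (r + k) _)))

    near-arithmetic : ∀ k L T d → k ≡ a + (2 + c) → L ≡ (a + (2 + c)) * suc (a + (2 + c)) + 2 * r * (2 + c) →
                      T ≡ (r + k) * suc (2 * (r + k)) → d ≤ 2 * a → 2 * L + B + (2 * d + 4) < T + (2 * r + 4 * k)
    near-arithmetic k L T d refl refl refl d≤ = begin-strict
      2 * L + B + (2 * d + 4)           ≤⟨ +-monoʳ-≤ (2 * L + B) (+-monoˡ-≤ 4 (*-monoʳ-≤ 2 d≤)) ⟩
      -- With deg x replaced by 2a, the difference has only nonnegative coefficients and a positive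
      -- constant term. For r = 1 the bound deg x < k alone would leave 3a - c, which can be
      -- negative.
      2 * L + B + (2 * (2 * a) + 4)     <⟨ m<m+n _ z<s ⟩
      2 * L + B + (2 * (2 * a) + 4) + suc (2 * (r′ * r′) + 5 * r′ + 4 * (r′ * a) + (a + c + 1))   ≡⟨ identity a c r′ ⟩
      (r + k) * suc (2 * (r + k)) + (2 * r + 4 * k)  ∎
      where
      identity : ∀ a c r′ → 2 * ((a + (2 + c)) * suc (a + (2 + c)) + 2 * suc r′ * (2 + c)) + suc (2 * (suc r′ + (a + suc c)))
                   + (2 * (2 * a) + 4) + suc (2 * (r′ * r′) + 5 * r′ + 4 * (r′ * a) + (a + c + 1))
                 ≡ (suc r′ + (a + (2 + c))) * suc (2 * (suc r′ + (a + (2 + c)))) + (2 * suc r′ + 4 * (a + (2 + c)))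
      identity = solve-∀

    u-arithmetic : ∀ k L T d → k ≡ a + (2 + c) → L ≡ (a + (2 + c)) * suc (a + (2 + c)) + 2 * r * (2 + c) →
                   T ≡ (r + k) * suc (2 * (r + k)) → d ≤ 2 * a + 2 → 2 * L + 2 * d < T + 2 * k
    u-arithmetic k L T d refl refl refl d≤ = begin-strict
      2 * L + 2 * d                     ≤⟨ +-monoʳ-≤ (2 * L) (*-monoʳ-≤ 2 d≤) ⟩
      2 * L + 2 * (2 * a + 2)           <⟨ m<m+n _ z<s ⟩
      2 * L + 2 * (2 * a + 2) + suc (2 * (r′ * r′) + 5 * r′ + 4 * (r′ * a) + (a + c))   ≡⟨ identity a c r′ ⟩
      (r + k) * suc (2 * (r + k)) + 2 * k  ∎
      where
      identity : ∀ a c r′ → 2 * ((a + (2 + c)) * suc (a + (2 + c)) + 2 * suc r′ * (2 + c))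
                   + 2 * (2 * a + 2) + suc (2 * (r′ * r′) + 5 * r′ + 4 * (r′ * a) + (a + c))
                 ≡ (suc r′ + (a + (2 + c))) * suc (2 * (suc r′ + (a + (2 + c)))) + 2 * (a + (2 + c))
      identity = solve-∀

    result : Antimagic G
    result = antimagic near≢u
      (λ {x} x∈ → <⇒≢ (near<v x∈ (σ≤B (rank-< x∈))
        (near-arithmetic k L _ (deg x) k≡ L≡ T≡ (near≤2a x∈ (deg-near<k x∈)))))
      (<⇒≢ (u<v (u-arithmetic k L _ (deg u) k≡ L≡ T≡ u≤2a+2)))

  module ManyOdd (e₁ e₂ : Edge G) (e₁≢e₂ : e₁ ≢ e₂) (e₁∈ : e₁ ∈ H-at u) (e₂∈ : e₂ ∈ H-at u)
                 (a c r : ℕ) (k≡ : k ≡ a + (2 + c)) (3≤k : 3 ≤ k) (heavy≤ : length heavy ≤ 2 + c)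
                 (N≡ : length near ≡ suc (2 * r + k)) where
    open ≤-Reasoning

    -- In this case m = 2(r + k) + 1 is odd, and `B` equals m, now the largest label at `v`.
    B : ℕ
    B = suc (2 * (r + k))

    open Sequences a r using (σ; σ≤)

    σ≤B : ∀ {q} → q < length near → σ q ≤ B
    σ≤B {q} q<N = subst (λ z → σ q ≤ suc (2 * z)) top∸r (σ≤ {q} {2 * r + k} (s≤s⁻¹ (≤-trans q<N (≤-reflexive N≡))) a+2r≤top)
      where
      top∸r : 2 * r + k ∸ r ≡ r + k
      top∸r = trans (cong (_∸ r) (regroup r k)) (m+n∸m≡n r (r + k))
        where
        regroup : ∀ r y → 2 * r + y ≡ r + (r + y)
        regroup = solve-∀
      a+2r≤top : a + 2 * r ≤ 2 * r + k
      a+2r≤top = ≤-trans (≤-reflexive (+-comm a (2 * r))) (+-monoʳ-≤ (2 * r) (subst (a ≤_) (sym k≡) (m≤m+n a (2 + c))))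

    m≡ : ∣E∣ G ≡ suc (2 * (r + k))
    m≡ = trans ∣E∣≡ (trans (cong (_+ k) N≡) (regroup r k))
      where
      regroup : ∀ r k → suc (2 * r + k) + k ≡ suc (2 * (r + k))
      regroup = solve-∀

    open Many e₁ e₂ e₁≢e₂ e₁∈ e₂∈ a c r k≡ heavy≤ (≤-trans (n≤1+n _) (≤-reflexive (sym N≡)))
      (λ q<N → ≤-trans (σ≤B q<N) (≤-reflexive (sym m≡)))

    T≡ : ∑ suc (upTo (∣E∣ G)) ≡ suc (2 * (r + k)) * suc (r + k)
    T≡ = *-cancelˡ-≡ _ _ 2 (trans (2*∑-suc (∣E∣ G)) (trans (cong (λ m → m * suc m) m≡) (regroup (r + k))))
      where
      regroup : ∀ y → suc (2 * y) * suc (suc (2 * y)) ≡ 2 * (suc (2 * y) * suc y)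
      regroup = solve-∀

    near-arithmetic : ∀ k L T d → k ≡ a + (2 + c) → 3 ≤ k → L ≡ (a + (2 + c)) * suc (a + (2 + c)) + 2 * r * (2 + c) →
                      T ≡ suc (2 * (r + k)) * suc (r + k) → d < k →
                      2 * L + suc (2 * (r + k)) + (2 * d + 4) < T + (2 * r + 4 * k)
    near-arithmetic k L T d refl 3≤k refl refl d<k = begin-strict
      2 * L + suc (2 * (r + k)) + (2 * d + 4)                ≤⟨ +-monoʳ-≤ (2 * L + suc (2 * (r + k))) (+-monoˡ-≤ 4 (*-monoʳ-≤ 2 d≤)) ⟩
      -- For r = 0 the difference reduces to a + c = k - 2, which is positive because 3 ≤ k.
      2 * L + suc (2 * (r + k)) + (2 * (a + suc c) + 4)      <⟨ m<m+n _ (≤-trans 0<a+c (m≤n+m (a + c) (2 * (r * r) + 3 * r + 4 * (r * a)))) ⟩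
      2 * L + suc (2 * (r + k)) + (2 * (a + suc c) + 4) + (2 * (r * r) + 3 * r + 4 * (r * a) + (a + c))   ≡⟨ identity a c r ⟩
      suc (2 * (r + k)) * suc (r + k) + (2 * r + 4 * k)      ∎
      where
      a+2+c : a + (2 + c) ≡ suc (a + suc c)
      a+2+c = +-suc a (suc c)
      d≤ : d ≤ a + suc c
      d≤ = s≤s⁻¹ (subst (d <_) a+2+c d<k)
      0<a+c : 0 < a + c
      0<a+c = s≤s⁻¹ (s≤s⁻¹ (subst (3 ≤_) (trans a+2+c (cong suc (+-suc a c))) 3≤k))
      identity : ∀ a c r → 2 * ((a + (2 + c)) * suc (a + (2 + c)) + 2 * r * (2 + c)) + suc (2 * (r + (a + (2 + c))))
                   + (2 * (a + suc c) + 4) + (2 * (r * r) + 3 * r + 4 * (r * a) + (a + c))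
                 ≡ suc (2 * (r + (a + (2 + c)))) * suc (r + (a + (2 + c))) + (2 * r + 4 * (a + (2 + c)))
      identity = solve-∀

    u-arithmetic : ∀ k L T d → k ≡ a + (2 + c) → L ≡ (a + (2 + c)) * suc (a + (2 + c)) + 2 * r * (2 + c) →
                   T ≡ suc (2 * (r + k)) * suc (r + k) → d ≤ k → 2 * L + 2 * d < T + 2 * k
    u-arithmetic k L T d refl refl refl d≤k = +-mono-<-≤
      (subst (2 * L <_) (identity a c r) (m<m+n (2 * L) z<s)) (*-monoʳ-≤ 2 d≤k)
      where
      identity : ∀ a c r → 2 * ((a + (2 + c)) * suc (a + (2 + c)) + 2 * r * (2 + c))
                   + suc (2 * (r * r) + 3 * r + 4 * (r * a) + (a + (2 + c)))
                 ≡ suc (2 * (r + (a + (2 + c)))) * suc (r + (a + (2 + c)))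
      identity = solve-∀

    result : Antimagic G
    result = antimagic near≢u
      (λ {x} x∈ → <⇒≢ (near<v x∈ (σ≤B (rank-< x∈))
        (near-arithmetic k L _ (deg x) k≡ 3≤k L≡ T≡ (deg-near<k x∈))))
      (<⇒≢ (u<v (u-arithmetic k L _ (deg u) k≡ L≡ T≡ (deg≤k u))))

  parity-split : ∀ z → ∃[ r ] (z ≡ 2 * r ⊎ z ≡ suc (2 * r))
  parity-split zero    = 0 , inj₁ refl
  parity-split (suc z) with parity-split z
  ... | r , inj₁ eq = r , inj₂ (cong suc eq)
  ... | r , inj₂ eq = suc r , inj₁ (trans (cong suc eq) (sym (*-suc 2 r)))

  many : k < length near → 3 ≤ k → 2 ≤ deg u → Antimagic G
  many k<N 3≤k 2≤d with two-edges 2≤d | parity-split (length near ∸ k)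
  ... | e₁ , e₂ , e₁≢e₂ , e₁∈ , e₂∈ | r , parity =
    -- Any neighbour of `v` can serve as the vertex `x` in `heavy-bound`; one exists since k <
    -- `length near`.
    let x , x∈ = a-near near k<N
        a , k≡ = split-k x∈ 3≤k 2≤d
    in by-parity x x∈ a k≡ r parity
    where
    a-near : ∀ xs → k < length xs → ∃[ x ] x ∈ xs
    a-near (x ∷ _) _ = x , here refl

    N≡ : ∀ {z} → length near ∸ k ≡ z → length near ≡ z + k
    N≡ eq = trans (sym (m∸n+n≡m (<⇒≤ k<N))) (cong (_+ k) eq)

    by-parity : ∀ x → x ∈ near → ∀ a → k ≡ a + (2 + (length heavy ∸ 2)) → ∀ r →
                length near ∸ k ≡ 2 * r ⊎ length near ∸ k ≡ suc (2 * r) → Antimagic G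
    -- Since k < `length near`, an even difference is at least 2, so r is positive in the even case.
    by-parity x x∈ a k≡ zero    (inj₁ eq) = contradiction (N≡ eq) (<⇒≢ k<N ∘ sym)
    by-parity x x∈ a k≡ (suc r) (inj₁ eq) = ManyEven.result e₁ e₂ e₁≢e₂ e₁∈ e₂∈ a (length heavy ∸ 2) r k≡
      (m≤n+m∸n (length heavy) 2) (N≡ eq) (deg-near≤ k≡ 3≤k 2≤d) (deg-u≤ k≡ x∈)
    by-parity x x∈ a k≡ r       (inj₂ eq) = ManyOdd.result e₁ e₂ e₁≢e₂ e₁∈ e₂∈ a (length heavy ∸ 2) r k≡ 3≤k
      (m≤n+m∸n (length heavy) 2) (N≡ eq)

  center-antimagic : k < length near → 2 ≤ length near → Antimagic G
  center-antimagic k<N 2≤N = case ≤-<-connex (deg u) 1 of λ where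
    (inj₁ d≤1) → few k<N 2≤N d≤1
    (inj₂ 2≤d) → case m≤n⇒m<n∨m≡n (≤-trans 2≤d (deg≤k u)) of λ where
      (inj₁ 3≤k) → many k<N 3≤k 2≤d
      (inj₂ 2≡k) → two k<N (sym 2≡k) 2≤d

-- From the maximum degree to a centre with a unique non-neighbour

module _ {n : ℕ} (G : Graph n) where
  open Graph G

  max-degree-attained : 0 < Δ G → ∃[ v ] degree G v ≡ Δ G
  max-degree-attained 0<Δ with argmax-sel id 0 (map (degree G) (allFin n))
  -- The maximum is either the default value 0 or an entry of the list; positivity rules out the
  -- former.
  ... | inj₁ Δ≡0 = contradiction (sym Δ≡0) (<⇒≢ 0<Δ)
  ... | inj₂ Δ∈ with ∈-map⁻ (degree G) Δ∈
  ...   | v , _ , Δ≡ = v , sym Δ≡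

  -- The list `far` of vertices not adjacent to `v` has length n - (n - 2) = 2, and `v` itself is
  -- one of its entries.
  unique-non-neighbour : ∀ v → 2 + degree G v ≡ n →
    ∃[ u ] (u ≢ v × ¬ T (adj v u) × (∀ x → x ≢ v → x ≢ u → T (adj v x)))
  unique-non-neighbour v deg≡ = from-pair far far-unique length-far v∈far id far-complete
    where
    far : List (Fin n)
    far = filter (λ x → ¬? (T? (adj v x))) (allFin n)

    far-unique : Unique far
    far-unique = Unique.filter⁺ (λ x → ¬? (T? (adj v x))) (Unique.allFin⁺ n)

    length-far : length far ≡ 2
    length-far = +-cancelˡ-≡ (degree G v) (length far) 2 (begin
      degree G v + length far   ≡⟨ length-filter-¬ (λ x → T? (adj v x)) (allFin n) ⟩
      length (allFin n)         ≡⟨ length-tabulate {n = n} id ⟩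
      n                         ≡⟨ deg≡ ⟨
      2 + degree G v            ≡⟨ +-comm 2 (degree G v) ⟩
      degree G v + 2            ∎)
      where open ≡-Reasoning

    v∈far : v ∈ far
    v∈far = ∈-filter⁺ (λ x → ¬? (T? (adj v x))) (∈-allFin v) (subst T (irrefl v))

    far-complete : ∀ x → ¬ T (adj v x) → x ∈ far
    far-complete x = ∈-filter⁺ (λ x → ¬? (T? (adj v x))) (∈-allFin x)

    others : ∀ {xs u} → (∀ x → ¬ T (adj v x) → x ∈ xs) → (∀ {x} → x ∈ xs → x ≡ v ⊎ x ≡ u) →
             ∀ x → x ≢ v → x ≢ u → T (adj v x)
    others complete only x x≢v x≢u with T? (adj v x)
    ... | yes a = a
    ... | no ¬a with only (complete x ¬a)
    ...   | inj₁ x≡v = contradiction x≡v x≢v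
    ...   | inj₂ x≡u = contradiction x≡u x≢u

    -- A variable list stands for `far` so that it can be matched; `v` may be its first or its
    -- second entry.
    from-pair : ∀ xs → Unique xs → length xs ≡ 2 → v ∈ xs → (∀ {x} → x ∈ xs → x ∈ far) → (∀ x → ¬ T (adj v x) → x ∈ xs) →
      ∃[ u ] (u ≢ v × ¬ T (adj v u) × (∀ x → x ≢ v → x ≢ u → T (adj v x)))
    from-pair (v ∷ u ∷ []) ((v≢u ∷ _) ∷ _) _ (here refl) sound complete =
      u , v≢u ∘ sym , proj₂ (∈-filter⁻ (λ x → ¬? (T? (adj v x))) {xs = allFin n} (sound (there (here refl)))) ,
      others complete λ where
        (here eq)         → inj₁ eq
        (there (here eq)) → inj₂ eq
    from-pair (u ∷ v ∷ []) ((u≢v ∷ _) ∷ _) _ (there (here refl)) sound complete =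
      u , u≢v , proj₂ (∈-filter⁻ (λ x → ¬? (T? (adj v x))) {xs = allFin n} (sound (here refl))) ,
      others complete λ where
        (here eq)         → inj₂ eq
        (there (here eq)) → inj₁ eq

lemma4p4 : (n : ℕ) → 4 ≤ n → (G : Graph n) → Δ G ≡ n ∸ 2 → ∣E∣ G ≤ 2 * n ∸ 5 → Antimagic G
lemma4p4 n 4≤n G Δ≡ m≤ = from-max (max-degree-attained G (subst (0 <_) (sym Δ≡) (m<n⇒0<n∸m (≤-trans (n≤1+n 3) 4≤n))))
  where
  few-edges : ∀ n k → 4 ≤ n → n ∸ 2 + k ≤ 2 * n ∸ 5 → k < n ∸ 2
  few-edges n k 4≤n le with m≤n⇒∃[o]m+o≡n 4≤n
  -- Writing n = 4 + o makes the truncated subtractions exact: n - 2 = 2 + o and 2n - 5 = (2 + o) +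
  -- (1 + o).
  ... | o , refl = s≤s (+-cancelˡ-≤ (2 + o) k (1 + o)
      (subst (2 + o + k ≤_) (trans (cong (_∸ 5) (regroup o)) (m+n∸m≡n 5 (2 + o + (1 + o)))) le))
    where
    regroup : ∀ o → 2 * (4 + o) ≡ 5 + (2 + o + (1 + o))
    regroup = solve-∀

  from-center : ∀ v → degree G v ≡ n ∸ 2 →
    ∃[ u ] (u ≢ v × ¬ T (Graph.adj G v u) × (∀ x → x ≢ v → x ≢ u → T (Graph.adj G v x))) → Antimagic G
  from-center v deg≡ (u , u≢v , u-far , others-near) = center-antimagic
      (subst (k <_) (sym deg≡) (few-edges n k 4≤n (subst (_≤ 2 * n ∸ 5) (trans ∣E∣≡ (cong (_+ k) deg≡)) m≤)))
      (subst (2 ≤_) (sym deg≡) (∸-monoˡ-≤ 2 4≤n))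
    where
    open Center G v u u≢v u-far others-near using (k; ∣E∣≡)
    open Cases G v u u≢v u-far others-near using (center-antimagic)

  from-max : ∃[ v ] degree G v ≡ Δ G → Antimagic G
  from-max (v , deg≡Δ) = from-center v (trans deg≡Δ Δ≡) (unique-non-neighbour G v
    (trans (cong (2 +_) (trans deg≡Δ Δ≡)) (m+[n∸m]≡n (≤-trans (s≤s (s≤s z≤n)) 4≤n))))
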